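{- Let $G$ be a finite simple graph on $n \geq 11$ vertices with independence number $\alpha(G) = 2$. If the maximum degree satisfies $\Delta(G) < 19n/29 - 1$, then $G$ contains a strong immersion of the complete graph $K_{\chi(G)}$, where $\chi(G)$ is the chromatic number of $G$.
   Context: All graphs are finite and simple. An immersion of a graph $H$ in a graph $G$ is a minimal subgraph $I$ of $G$ for which there is an injection $\mathrm{i}\colon V(H)\to V(I)$ and a set of pairwise edge-disjoint paths $\{P_e : e\in E(H)\}$ in $I$ such that the end vertices of $P_{uv}$ are precisely $\mathrm{i}(u)$ and $\mathrm{i}(v)$. The vertices in the image of $\mathrm{i}$ are the branch vertices. The immersion is strong if no internal vertex of any path $P_e$ is a branch vertex. -}

module Defs where

open import Data.Nat using (ℕ; zero; suc; _⊔_; _≤_)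
open import Data.Bool using (Bool; true; false)
open import Data.Fin using (Fin; _<_)
open import Data.Fin.Subset using (Subset; _∈_; ∣_∣)
open import Data.Vec using (tabulate)
open import Data.List using (List; []; _∷_; foldr; map; allFin)
open import Data.List.Relation.Unary.Unique.Propositional using (Unique)
import Data.List.Membership.Propositional as LM
open import Data.Product using (Σ; ∃; _×_; _,_)
open import Data.Sum using (_⊎_)
open import Relation.Binary.PropositionalEquality using (_≡_; _≢_)
open import Relation.Nullary using (¬_)
open import Function.Definitions using (Injective)

record Graph (n : ℕ) : Set where
  field
    adj   : Fin n → Fin n → Bool
    sym   : ∀ u v → adj u v ≡ adj v u
    irref : ∀ v → adj v v ≡ false
open Graph public

module _ {n : ℕ} (G : Graph n) where

  Independent : Subset n → Set
  Independent S = ∀ u v → u ∈ S → v ∈ S → adj G u v ≡ false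

  IndependenceNumber : ℕ → Set
  IndependenceNumber k =
    (Σ (Subset n) λ S → Independent S × ∣ S ∣ ≡ k)
    × (∀ S → Independent S → ∣ S ∣ ≤ k)

  neighbourhood : Fin n → Subset n
  neighbourhood v = tabulate (adj G v)

  degree : Fin n → ℕ
  degree v = ∣ neighbourhood v ∣

  maxDegree : ℕ
  maxDegree = foldr _⊔_ 0 (map degree (allFin n))

  Colourable : ℕ → Set
  Colourable k = Σ (Fin n → Fin k) λ c → ∀ u v → adj G u v ≡ true → c u ≢ c v

  ChromaticNumber : ℕ → Set
  ChromaticNumber k = Colourable k × (∀ m → Colourable m → k ≤ m)

  data Walk : Fin n → Fin n → Set where
    nil  : ∀ {a} → Walk a a
    cons : ∀ {a c b} → adj G a c ≡ true → Walk c b → Walk a b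

  vertices : ∀ {a b} → Walk a b → List (Fin n)
  vertices {a} nil = a ∷ []
  vertices {a} (cons _ w) = a ∷ vertices w

  initVertices : ∀ {a b} → Walk a b → List (Fin n)
  initVertices nil = []
  initVertices {a} (cons _ w) = a ∷ initVertices w

  internal : ∀ {a b} → Walk a b → List (Fin n)
  internal nil = []
  internal (cons _ w) = initVertices w

  edges : ∀ {a b} → Walk a b → List (Fin n × Fin n)
  edges nil = []
  edges {a} (cons {c = c} _ w) = (a , c) ∷ edges w

  record Path (a b : Fin n) : Set where
    field
      walk   : Walk a b
      simple : Unique (vertices walk)
  open Path public

  SameEdge : Fin n × Fin n → Fin n × Fin n → Set
  SameEdge (x , y) (x' , y') = (x ≡ x' × y ≡ y') ⊎ (x ≡ y' × y ≡ x')

  EdgeDisjoint : ∀ {a b c d} → Walk a b → Walk c d → Set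
  EdgeDisjoint w w' = ∀ e e' → e LM.∈ edges w → e' LM.∈ edges w' → ¬ SameEdge e e'

  record StrongImmersionOfComplete (k : ℕ) : Set where
    field
      branch    : Fin k → Fin n
      branchInj : Injective _≡_ _≡_ branch
      path      : (u v : Fin k) → u < v → Path (branch u) (branch v)
      disjoint  : ∀ u v u' v' (h : u < v) (h' : u' < v') →
                  ¬ (u ≡ u' × v ≡ v') →
                  EdgeDisjoint (walk (path u v h)) (walk (path u' v' h'))
      strong    : ∀ u v (h : u < v) (x : Fin n) →
                  x LM.∈ internal (walk (path u v h)) →
                  ∀ w → x ≢ branch w

{-# OPTIONS --safe #-}

-- Let H be the complement of G: it is triangle-free with minimum degree greater than 10n/29.
--
-- If H has a stable set of size at least n/2, a largest one, J, is a clique of G, and Hall's theorem matches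
-- the other vertices into J along H, so that G is |J|-colourable. Otherwise let H′ be a maximal triangle-free
-- supergraph of H, w a vertex of maximum degree in H′, and J = N(w). Hall's theorem now matches J into its
-- complement along H, so χ(G) ≤ n − |J|, and all vertices outside J serve as branch vertices.
--
-- The degree bound enters once more, through the fact that H′ has no hexagon with nonadjacent antipodal
-- vertices. It follows that every stable set of H′ lies in a neighbourhood, and that there are s ∈ J and r ∉ J
-- such that J, N(s) and N(r) cover H′. Let Z be the set of vertices outside J ∪ N(s). Hall's theorem gives
-- distinct H′-neighbours z* ∈ J of the vertices z ∈ Z. A pair k ∈ N(s), z ∈ Z that is adjacent in H′ is routed
-- along k, z*, y, z where y ∈ J is not adjacent to z in H′; for each z these y are chosen distinct. Two routes
-- sharing an edge inside J would close a forbidden hexagon.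
module Submission where

open import Defs hiding (sym)
open import Algebra.Properties.CommutativeSemigroup using (interchange)
open import Data.Bool using (Bool; true; false; _∧_; _∨_; not; T)
open import Data.Bool.ListAction using (any)
import Data.Bool as Bool
import Data.Bool.Properties as Bool
open import Data.Empty using (⊥; ⊥-elim)
open import Data.Fin using (Fin; zero; suc; _≟_; inject≤; fromℕ<)
import Data.Fin as Fin
open import Data.Fin.Properties using (any?; all?)
import Data.Fin.Properties as Fin
import Data.Fin.Subset as Subset
open import Data.Fin.Subset.Properties using (anySubset?)
open import Data.List using (List; []; _∷_; allFin; cartesianProduct; foldr)
import Data.List as List
import Data.List.Membership.Propositional as List
open import Data.List.Membership.Propositional.Properties using (∈-allFin; ∈-cartesianProduct⁺)
open import Data.List.Relation.Unary.All using (All; []; _∷_)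
import Data.List.Relation.Unary.All as All
import Data.List.Relation.Unary.All.Properties as All
open import Data.List.Relation.Unary.AllPairs using ([]; _∷_)
open import Data.List.Relation.Unary.Any using (here; there)
open import Data.Nat using (ℕ; zero; suc; _+_; _*_; _⊔_; _≤_; _<_; _≤?_; _<?_; z≤n; s≤s; _≤ᵇ_; _≡ᵇ_)
open import Data.Nat.Properties hiding (_≟_)
open import Data.Nat.Solver using (module +-*-Solver)
open import Data.Product using (∃; ∃₂; _×_; _,_; proj₁; proj₂)
open import Data.Sum using (_⊎_; inj₁; inj₂; [_,_]′)
open import Data.Unit using (⊤; tt)
open import Data.Vec using (Vec; []; _∷_; lookup; tabulate)
import Data.Vec as Vec
open import Data.Vec.Properties using (lookup∘tabulate; []=⇒lookup)
open import Function using (_∘_; id; case_of_)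
open import Relation.Binary.PropositionalEquality using (_≡_; _≢_; ≢-sym; refl; sym; trans; cong; cong₂; subst; subst₂; module ≡-Reasoning)
open import Relation.Nullary using (¬_; Dec; yes; no; does; contradiction)
open import Relation.Nullary.Decidable using (dec-true; map′; decidable-stable; _×-dec_; _⊎-dec_; _→-dec_; ¬?)

open import Algebra.Properties.Semiring.Sum +-*-semiring using (sum; sum-cong-≗; ∑-distrib-+; *-distribˡ-sum)

-- Finite sets

bit : Bool → ℕ
bit true  = 1
bit false = 0

bit-mono : ∀ {a b} → (a ≡ true → b ≡ true) → bit a ≤ bit b
bit-mono {false} i = z≤n
bit-mono {true}  i rewrite i refl = ≤-refl

sum-mono-≤ : ∀ {n} {f g : Fin n → ℕ} → (∀ x → f x ≤ g x) → sum f ≤ sum g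
sum-mono-≤ {zero}  f≤g = z≤n
sum-mono-≤ {suc n} f≤g = +-mono-≤ (f≤g zero) (sum-mono-≤ (f≤g ∘ suc))

sum-mono-< : ∀ {n} {f g : Fin n → ℕ} → (∀ x → f x ≤ g x) → ∀ x → f x < g x → sum f < sum g
sum-mono-< f≤g zero    lt = +-mono-<-≤ lt (sum-mono-≤ (f≤g ∘ suc))
sum-mono-< f≤g (suc x) lt = +-mono-≤-< (f≤g zero) (sum-mono-< (f≤g ∘ suc) x lt)

sum-const : ∀ n c → sum {n} (λ _ → c) ≡ n * c
sum-const zero    c = refl
sum-const (suc n) c = cong (c +_) (sum-const n c)

infix 4 _∈_ _∉_ _⊆_ _∈?_
infixr 7 _∩_
infixr 6 _∪_

-- Wrapping membership and sealing the set operations lets Agda infer the sets involved.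
record VSet (n : ℕ) : Set where
  constructor set
  field char : Fin n → Bool
open VSet

record _∈_ {n : ℕ} (x : Fin n) (p : VSet n) : Set where
  constructor mem
  field holds : char p x ≡ true
open _∈_

private variable
  n k : ℕ
  p q r s : VSet n
  x y : Fin n

_∉_ : Fin n → VSet n → Set
x ∉ p = ¬ x ∈ p

_⊆_ : VSet n → VSet n → Set
p ⊆ q = ∀ {x} → x ∈ p → x ∈ q

_∈?_ : (x : Fin n) (p : VSet n) → Dec (x ∈ p)
x ∈? p = map′ mem holds (char p x Bool.≟ true)

opaque
  _∪_ _∩_ : VSet n → VSet n → VSet n
  p ∪ q = set λ x → char p x ∨ char q x
  p ∩ q = set λ x → char p x ∧ char q x

  ∁ : VSet n → VSet n
  ∁ p = set λ x → not (char p x)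

  ∅ : VSet n
  ∅ = set λ _ → false

  ｛_｝ : {P : Fin n → Set} → (∀ x → Dec (P x)) → VSet n
  ｛ P? ｝ = set λ x → does (P? x)

  card : VSet n → ℕ
  card p = sum (λ x → bit (char p x))

  ｛｝⁺ : {P : Fin n → Set} (P? : ∀ x → Dec (P x)) → P x → x ∈ ｛ P? ｝
  ｛｝⁺ P? px = mem (dec-true (P? _) px)

  ｛｝⁻ : {P : Fin n → Set} (P? : ∀ x → Dec (P x)) → x ∈ ｛ P? ｝ → P x
  ｛｝⁻ {x = x} P? (mem e) with P? x
  ... | yes px = px
  ... | no _ with () ← e

  ∪⁺ˡ : x ∈ p → x ∈ p ∪ q
  ∪⁺ˡ (mem e) = mem (cong (_∨ _) e)

  ∪⁺ʳ : x ∈ q → x ∈ p ∪ q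
  ∪⁺ʳ (mem e) = mem (trans (cong (_ ∨_) e) (Bool.∨-zeroʳ _))

  ∪⁻ : x ∈ p ∪ q → x ∈ p ⊎ x ∈ q
  ∪⁻ {x = x} {p = p} (mem e) with char p x in eq
  ... | true  = inj₁ (mem eq)
  ... | false = inj₂ (mem e)

  ∩⁺ : x ∈ p → x ∈ q → x ∈ p ∩ q
  ∩⁺ (mem e) (mem f) = mem (cong₂ _∧_ e f)

  ∩⁻ : x ∈ p ∩ q → x ∈ p × x ∈ q
  ∩⁻ {x = x} {p = p} (mem e) with char p x in eq
  ... | true  = mem eq , mem e
  ... | false with () ← e

  ∁⁺ : x ∉ p → x ∈ ∁ p
  ∁⁺ x∉p = mem (cong not (Bool.¬-not (x∉p ∘ mem)))

  ∁⁻ : x ∈ ∁ p → x ∉ p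
  ∁⁻ (mem e) (mem f) rewrite f with () ← e

  x∉∅ : x ∉ ∅
  x∉∅ (mem ())

  card-⊆ : p ⊆ q → card p ≤ card q
  card-⊆ p⊆q = sum-mono-≤ λ x → bit-mono λ e → holds (p⊆q (mem {x = x} e))

  card-⊂ : p ⊆ q → x ∈ q → x ∉ p → card p < card q
  card-⊂ {x = x} p⊆q x∈q x∉p = sum-mono-< (λ y → bit-mono λ e → holds (p⊆q (mem {x = y} e))) x
    (subst₂ (λ a b → bit a < bit b) (sym (Bool.¬-not (x∉p ∘ mem))) (sym (holds x∈q)) (s≤s z≤n))

  card-∪-∩ : (p q : VSet n) → card (p ∪ q) + card (p ∩ q) ≡ card p + card q
  card-∪-∩ p q = begin
    card (p ∪ q) + card (p ∩ q)
      ≡⟨ ∑-distrib-+ (λ x → bit (char p x ∨ char q x)) (λ x → bit (char p x ∧ char q x)) ⟨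
    sum (λ x → bit (char p x ∨ char q x) + bit (char p x ∧ char q x))
      ≡⟨ sum-cong-≗ (λ x → pointwise (char p x) (char q x)) ⟩
    sum (λ x → bit (char p x) + bit (char q x))
      ≡⟨ ∑-distrib-+ (λ x → bit (char p x)) (λ x → bit (char q x)) ⟩
    card p + card q ∎
    where
    open ≡-Reasoning
    pointwise : ∀ a b → bit (a ∨ b) + bit (a ∧ b) ≡ bit a + bit b
    pointwise true  true  = refl
    pointwise true  false = refl
    pointwise false true  = refl
    pointwise false false = refl

  card-∅ : card (∅ {n}) ≡ 0
  card-∅ {n} = trans (sum-const n 0) (*-zeroʳ n)

  card-∁∅ : card (∁ (∅ {n})) ≡ n
  card-∁∅ {n} = trans (sum-const n 1) (*-identityʳ n)

⁅_⁆ : Fin n → VSet n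
⁅ x ⁆ = ｛ x ≟_ ｝

x∈⁅x⁆ : (x : Fin n) → x ∈ ⁅ x ⁆
x∈⁅x⁆ x = ｛｝⁺ (x ≟_) refl

x∈⁅y⁆⁻ : y ∈ ⁅ x ⁆ → x ≡ y
x∈⁅y⁆⁻ = ｛｝⁻ (_ ≟_)

opaque
  unfolding card
  card-⁅⁆ : (x : Fin n) → card ⁅ x ⁆ ≡ 1
  card-⁅⁆ {suc n} zero = cong suc (trans (sum-const n 0) (*-zeroʳ n))
  card-⁅⁆ (suc x) = trans (sum-cong-≗ (cong bit ∘ step)) (card-⁅⁆ x)
    where
    step : ∀ y → char ⁅ suc x ⁆ (suc y) ≡ char ⁅ x ⁆ y
    step y with x ≟ y
    ... | yes _ = refl
    ... | no  _ = refl

card-full : {p : VSet n} → (∀ x → x ∈ p) → card p ≡ n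
card-full {p = p} all = ≤-antisym (≤-trans (card-⊆ λ _ → ∁⁺ x∉∅) (≤-reflexive card-∁∅))
                                  (≤-trans (≤-reflexive (sym card-∁∅)) (card-⊆ λ _ → all _))

card-≤ : (p : VSet n) → card p ≤ n
card-≤ p = ≤-trans (card-⊆ λ _ → ∁⁺ x∉∅) (≤-reflexive card-∁∅)

card-none : {p : VSet n} → (∀ x → x ∉ p) → card p ≡ 0
card-none none = n≤0⇒n≡0 (≤-trans (card-⊆ λ x∈p → contradiction x∈p (none _)) (≤-reflexive card-∅))

card-cong : p ⊆ q → q ⊆ p → card p ≡ card q
card-cong p⊆q q⊆p = ≤-antisym (card-⊆ p⊆q) (card-⊆ q⊆p)

card-∪-≤ : (p q : VSet n) → card (p ∪ q) ≤ card p + card q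
card-∪-≤ p q = ≤-trans (m≤m+n _ _) (≤-reflexive (card-∪-∩ p q))

card-∪-disjoint : {p q : VSet n} → (∀ x → x ∈ p → x ∉ q) → card (p ∪ q) ≡ card p + card q
card-∪-disjoint {p = p} {q = q} dj = begin
  card (p ∪ q)                ≡⟨ +-identityʳ _ ⟨
  card (p ∪ q) + 0            ≡⟨ cong (card (p ∪ q) +_) (card-none λ x x∈ → let a , b = ∩⁻ x∈ in dj x a b) ⟨
  card (p ∪ q) + card (p ∩ q) ≡⟨ card-∪-∩ p q ⟩
  card p + card q             ∎
  where open ≡-Reasoning

disjoint-≤ : {p q r : VSet n} → (∀ x → x ∈ p → x ∉ q) → p ⊆ r → q ⊆ r → card p + card q ≤ card r
disjoint-≤ dj p⊆r q⊆r = ≤-trans (≤-reflexive (sym (card-∪-disjoint dj)))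
  (card-⊆ λ x∈ → [ p⊆r , q⊆r ]′ (∪⁻ x∈))

cover-≤ : {p q r : VSet n} → (∀ x → x ∈ p → x ∈ q ⊎ x ∈ r) → card p ≤ card q + card r
cover-≤ cv = ≤-trans (card-⊆ λ x∈ → [ ∪⁺ˡ , ∪⁺ʳ ]′ (cv _ x∈)) (card-∪-≤ _ _)

card-∁ : (p : VSet n) → card p + card (∁ p) ≡ n
card-∁ p = trans (sym (card-∪-disjoint λ x a b → ∁⁻ b a))
  (card-full λ x → case x ∈? p of λ where
    (yes x∈p) → ∪⁺ˡ x∈p
    (no x∉p)  → ∪⁺ʳ (∁⁺ x∉p))

card-split : (p q : VSet n) → card (p ∩ q) + card (p ∩ ∁ q) ≡ card p
card-split p q = ≤-antisym
  (disjoint-≤ (λ x a b → ∁⁻ (proj₂ (∩⁻ b)) (proj₂ (∩⁻ a))) (proj₁ ∘ ∩⁻) (proj₁ ∘ ∩⁻))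
  (cover-≤ λ x x∈p → case x ∈? q of λ where
    (yes x∈q) → inj₁ (∩⁺ x∈p x∈q)
    (no x∉q)  → inj₂ (∩⁺ x∈p (∁⁺ x∉q)))

witness : (p q : VSet n) → card p < card q → ∃ λ x → x ∈ q × x ∉ p
witness p q lt with any? (λ x → (x ∈? q) ×-dec ¬? (x ∈? p))
... | yes w = w
... | no ¬w = contradiction lt (≤⇒≯ (card-⊆ λ {x} x∈q → decidable-stable (x ∈? p) λ x∉p → ¬w (x , x∈q , x∉p)))

member : (p : VSet n) → 0 < card p → ∃ λ x → x ∈ p
member p lt = let x , x∈p , _ = witness ∅ p (subst (_< card p) (sym card-∅) lt) in x , x∈p

-- Hill climbing: each improvement raises `f a` by at least one, so the slack `k` above `f a`
-- shrinks and serves as fuel.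
maximise : {A : Set} {P : A → Set} (f : A → ℕ) (bound : ℕ) → (∀ a → f a ≤ bound) →
           (∀ k → Dec (∃ λ a → P a × k < f a)) → ∃ P → ∃ λ a → P a × ∀ b → P b → f b ≤ f a
maximise {A} {P} f bound f≤ improve (a₀ , pa₀) = go bound a₀ pa₀ λ b _ → ≤-trans (f≤ b) (m≤n+m bound (f a₀))
  where
  go : ∀ k a → P a → (∀ b → P b → f b ≤ f a + k) → ∃ λ a → P a × ∀ b → P b → f b ≤ f a
  go zero    a pa ub = a , pa , λ b pb → ≤-trans (ub b pb) (≤-reflexive (+-identityʳ _))
  go (suc k) a pa ub with improve (f a)
  ... | no ¬w = a , pa , λ b pb → ≮⇒≥ λ lt → ¬w (b , pb , lt)
  ... | yes (a′ , pa′ , lt) = go k a′ pa′ λ b pb →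
    ≤-trans (ub b pb) (≤-trans (≤-reflexive (+-suc _ _)) (+-monoˡ-≤ k lt))

argmax : {P : Fin n → Set} → (∀ x → Dec (P x)) → (f : Fin n → ℕ) (bound : ℕ) → (∀ x → f x ≤ bound) → ∃ P →
         ∃ λ x → P x × ∀ y → P y → f y ≤ f x
argmax P? f bound f≤ = maximise f bound f≤ λ k → any? λ x → P? x ×-dec (k <? f x)

-- Hall's theorem

-- Boolean vectors can be enumerated where characteristic functions cannot. Passing through a vector
-- preserves a set only pointwise, hence `respects`.
anyVSet? : {P : VSet n → Set} → (∀ p → Dec (P p)) → (∀ {p q} → p ⊆ q → q ⊆ p → P p → P q) → Dec (∃ P)
anyVSet? {n} {P} P? respects = map′ (λ (s , ps) → set (lookup s) , ps)
  (λ (p , pp) → tabulate (char p) , respects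
    (λ {x} (mem e) → mem (trans (lookup∘tabulate (char p) x) e))
    (λ {x} (mem e) → mem (trans (sym (lookup∘tabulate (char p) x)) e)) pp)
  (anySubset? (λ s → P? (set (lookup s))))

_⊆?_ : (p q : VSet n) → Dec (∀ x → x ∈ p → x ∈ q)
p ⊆? q = all? λ x → (x ∈? p) →-dec (x ∈? q)

opaque
  image : (Fin n → VSet n) → VSet n → VSet n
  image R Q = ｛ (λ b → any? λ a → (a ∈? Q) ×-dec (b ∈? R a)) ｝

  image⁺ : ∀ {R : Fin n → VSet n} {Q a b} → a ∈ Q → b ∈ R a → b ∈ image R Q
  image⁺ a∈Q b∈Ra = ｛｝⁺ _ (_ , a∈Q , b∈Ra)

  image⁻ : ∀ {R : Fin n → VSet n} {Q b} → b ∈ image R Q → ∃ λ a → a ∈ Q × b ∈ R a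
  image⁻ = ｛｝⁻ _

image-mono : ∀ {R R′ : Fin n → VSet n} {Q Q′} → Q ⊆ Q′ → (∀ {a} → a ∈ Q → R a ⊆ R′ a) → image R Q ⊆ image R′ Q′
image-mono Q⊆ R⊆ b∈ = let a , a∈Q , b∈Ra = image⁻ b∈ in image⁺ (Q⊆ a∈Q) (R⊆ a∈Q b∈Ra)

Hall : (Fin n → VSet n) → VSet n → Set
Hall R S = ∀ Q → Q ⊆ S → card Q ≤ card (image R Q)

Violates : (Fin n → VSet n) → VSet n → VSet n → Set
Violates R S Q = (∀ x → x ∈ Q → x ∈ S) × card (image R Q) < card Q

Hall-or-violated : (R : Fin n → VSet n) (S : VSet n) → Hall R S ⊎ ∃ (Violates R S)
Hall-or-violated R S with anyVSet? {P = Violates R S} (λ Q → (Q ⊆? S) ×-dec (card (image R Q) <? card Q))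
  (λ p⊆q q⊆p (p⊆S , lt) → (λ x → p⊆S x ∘ q⊆p) ,
    subst₂ _<_ (card-cong (image-mono p⊆q λ _ → id) (image-mono q⊆p λ _ → id)) (card-cong p⊆q q⊆p) lt)
... | yes v = inj₂ v
... | no ¬v = inj₁ λ Q Q⊆S → ≮⇒≥ λ lt → ¬v (Q , (λ _ → Q⊆S) , lt)

_without_ : (Fin n → VSet n) → Fin n × Fin n → Fin n → VSet n
(R without (a , b)) a′ = R a′ ∩ ∁ ｛ (λ b′ → (a ≟ a′) ×-dec (b ≟ b′)) ｝

module _ (R : Fin n → VSet n) {a b : Fin n} where
  without⁺ : ∀ {a′ b′} → b′ ∈ R a′ → ¬ (a ≡ a′ × b ≡ b′) → b′ ∈ (R without (a , b)) a′
  without⁺ b′∈ ≢ = ∩⁺ b′∈ (∁⁺ (≢ ∘ ｛｝⁻ _))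

  without⁻ : ∀ {a′} → (R without (a , b)) a′ ⊆ R a′
  without⁻ = proj₁ ∘ ∩⁻

  total-without : b ∈ R a → sum (card ∘ (R without (a , b))) < sum (card ∘ R)
  total-without b∈ = sum-mono-< (λ a′ → card-⊆ (without⁻ {a′})) a
    (card-⊂ (without⁻ {a}) b∈ λ b∈′ → ∁⁻ (proj₂ (∩⁻ b∈′)) (｛｝⁺ _ (refl , refl)))

record Matching (R : Fin n → VSet n) (S : VSet n) : Set where
  field
    match    : Fin n → Fin n
    match∈   : ∀ {a} → a ∈ S → match a ∈ R a
    matchInj : ∀ {a a′} → a ∈ S → a′ ∈ S → match a ≡ match a′ → a ≡ a′

-- Rado's proof of Hall's theorem deletes pairs from R as long as Hall's condition survives. Violations for the
-- deletions of (a , b₁) and (a , b₂) contradict Hall's condition for their union and their intersection minus a.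
uncross : (R : Fin n → VSet n) (S : VSet n) → Hall R S → ∀ {a b₁ b₂} → b₁ ≢ b₂ →
          ∃ (Violates (R without (a , b₁)) S) → ∃ (Violates (R without (a , b₂)) S) → ⊥
uncross {n} R S hall {a} {b₁} {b₂} b₁≢b₂ (Q₁ , Q₁⊆S , lt₁) (Q₂ , Q₂⊆S , lt₂) = <-irrefl refl (begin-strict
    card Q₁ + card Q₂                     ≡⟨ card-∪-∩ Q₁ Q₂ ⟨
    card A + card (Q₁ ∩ Q₂)               ≤⟨ +-monoʳ-≤ (card A) (cover-≤ split) ⟩
    card A + (card B + card ⁅ a ⁆)        ≡⟨ cong (λ k → card A + (card B + k)) (card-⁅⁆ a) ⟩
    card A + (card B + 1)                 ≡⟨ trans (sym (+-assoc (card A) _ _)) (+-comm _ 1) ⟩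
    suc (card A + card B)                 ≤⟨ s≤s (+-mono-≤ (hall A A⊆S) (hall B B⊆S)) ⟩
    suc (card (image R A) + card (image R B)) ≤⟨ s≤s (+-mono-≤ (card-⊆ A⊆) (card-⊆ B⊆)) ⟩
    suc (card (N₁ ∪ N₂) + card (N₁ ∩ N₂)) ≡⟨ cong suc (card-∪-∩ N₁ N₂) ⟩
    -- Two strict violations lose two, whereas dropping `a` from the intersection cost only one.
    suc (card N₁) + card N₂               <⟨ +-mono-≤-< lt₁ lt₂ ⟩
    card Q₁ + card Q₂                     ∎)
  where
  open ≤-Reasoning
  N₁ N₂ A B : VSet n
  N₁ = image (R without (a , b₁)) Q₁
  N₂ = image (R without (a , b₂)) Q₂
  A = Q₁ ∪ Q₂
  B = (Q₁ ∩ Q₂) ∩ ∁ ⁅ a ⁆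
  A⊆S : A ⊆ S
  A⊆S x∈ = [ Q₁⊆S _ , Q₂⊆S _ ]′ (∪⁻ x∈)
  B⊆S : B ⊆ S
  B⊆S = Q₁⊆S _ ∘ proj₁ ∘ ∩⁻ ∘ proj₁ ∘ ∩⁻
  split : ∀ x → x ∈ Q₁ ∩ Q₂ → x ∈ B ⊎ x ∈ ⁅ a ⁆
  split x x∈ = case x ∈? ⁅ a ⁆ of λ where
    (yes x∈a) → inj₂ x∈a
    (no x∉a)  → inj₁ (∩⁺ x∈ (∁⁺ x∉a))
  -- A violating set contains `a`, since otherwise the deletion leaves its image unchanged. Hence
  -- `b₁`, if lost from `N₁`, is found in `N₂`.
  a∈ : ∀ {Q b} → (∀ x → x ∈ Q → x ∈ S) → card (image (R without (a , b)) Q) < card Q → a ∈ Q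
  a∈ {Q} Q⊆S lt = decidable-stable (a ∈? Q) λ a∉Q → <⇒≱ lt (≤-trans (hall Q (Q⊆S _))
    (card-⊆ (image-mono id λ x∈Q y∈ → without⁺ R y∈ λ (eq , _) → a∉Q (subst (_∈ Q) (sym eq) x∈Q))))
  A⊆ : image R A ⊆ N₁ ∪ N₂
  A⊆ {y} y∈ with image⁻ y∈
  ... | x , x∈A , y∈Rx with a ≟ x | b₁ ≟ y
  ... | yes refl | no b₁≢y = ∪⁺ˡ (image⁺ (a∈ Q₁⊆S lt₁) (without⁺ R y∈Rx (b₁≢y ∘ proj₂)))
  ... | yes refl | yes refl = ∪⁺ʳ (image⁺ (a∈ Q₂⊆S lt₂) (without⁺ R y∈Rx (b₁≢b₂ ∘ sym ∘ proj₂)))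
  ... | no a≢x | _ = [ (λ x∈ → ∪⁺ˡ (image⁺ x∈ (without⁺ R y∈Rx (a≢x ∘ proj₁))))
                     , (λ x∈ → ∪⁺ʳ (image⁺ x∈ (without⁺ R y∈Rx (a≢x ∘ proj₁)))) ]′ (∪⁻ x∈A)
  B⊆ : image R B ⊆ N₁ ∩ N₂
  B⊆ y∈ = let x , x∈B , y∈Rx = image⁻ y∈
              x∈ , x∉a = ∩⁻ x∈B
              x∈Q₁ , x∈Q₂ = ∩⁻ x∈
              a≢x = λ eq → ∁⁻ x∉a (subst (_∈ ⁅ a ⁆) eq (x∈⁅x⁆ a))
          in ∩⁺ (image⁺ x∈Q₁ (without⁺ R y∈Rx (a≢x ∘ proj₁))) (image⁺ x∈Q₂ (without⁺ R y∈Rx (a≢x ∘ proj₁)))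

module _ (R : Fin n → VSet n) (S : VSet n) (hall : Hall R S)
         (functional : ∀ {a b b′} → a ∈ S → b ∈ R a → b′ ∈ R a → b ≡ b′) where

  private
    neighbour : ∀ {a} → a ∈ S → ∃ λ b → b ∈ R a
    neighbour {a} a∈S =
      let b , b∈ = member (image R ⁅ a ⁆) (≤-trans (≤-reflexive (sym (card-⁅⁆ a)))
                          (hall ⁅ a ⁆ λ x∈ → subst (_∈ S) (x∈⁅y⁆⁻ x∈) a∈S))
          x , x∈ , b∈Rx = image⁻ b∈
      in b , subst (λ x → b ∈ R x) (sym (x∈⁅y⁆⁻ x∈)) b∈Rx

    choose : Fin n → Fin n
    choose a with any? (λ b → b ∈? R a)
    ... | yes (b , _) = b
    -- Arbitrary default; `neighbour` rules this case out on `S`.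
    ... | no _        = a

    choose∈ : ∀ {a} → a ∈ S → choose a ∈ R a
    choose∈ {a} a∈S with any? (λ b → b ∈? R a)
    ... | yes (_ , b∈) = b∈
    ... | no none      = contradiction (neighbour a∈S) none

    choose-injective : ∀ {a a′} → a ∈ S → a′ ∈ S → choose a ≡ choose a′ → a ≡ a′
    choose-injective {a} {a′} a∈S a′∈S eq = decidable-stable (a ≟ a′) λ a≢a′ → <-irrefl refl (begin-strict
      1                          <⟨ s≤s (s≤s z≤n) ⟩
      1 + 1                      ≡⟨ cong₂ _+_ (card-⁅⁆ a) (card-⁅⁆ a′) ⟨
      card ⁅ a ⁆ + card ⁅ a′ ⁆   ≡⟨ card-∪-disjoint (λ x p q → a≢a′ (trans (x∈⁅y⁆⁻ p) (sym (x∈⁅y⁆⁻ q)))) ⟨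
      card (⁅ a ⁆ ∪ ⁅ a′ ⁆)      ≤⟨ hall _ pair⊆S ⟩
      card (image R (⁅ a ⁆ ∪ ⁅ a′ ⁆)) ≤⟨ card-⊆ image⊆ ⟩
      card ⁅ choose a ⁆          ≡⟨ card-⁅⁆ (choose a) ⟩
      1                          ∎)
      where
      open ≤-Reasoning
      pair⊆S : ⁅ a ⁆ ∪ ⁅ a′ ⁆ ⊆ S
      pair⊆S x∈ = [ (λ p → subst (_∈ S) (x∈⁅y⁆⁻ p) a∈S) , (λ p → subst (_∈ S) (x∈⁅y⁆⁻ p) a′∈S) ]′ (∪⁻ x∈)
      value : ∀ {x} → x ∈ ⁅ a ⁆ ∪ ⁅ a′ ⁆ → choose a ≡ choose x
      value x∈ = [ (λ p → cong choose (x∈⁅y⁆⁻ p)) , (λ p → trans eq (cong choose (x∈⁅y⁆⁻ p))) ]′ (∪⁻ x∈)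
      image⊆ : image R (⁅ a ⁆ ∪ ⁅ a′ ⁆) ⊆ ⁅ choose a ⁆
      image⊆ y∈ = let x , x∈ , y∈Rx = image⁻ y∈
                      x∈S = pair⊆S x∈
                  in subst (_∈ ⁅ choose a ⁆) (trans (value x∈) (functional x∈S (choose∈ x∈S) y∈Rx)) (x∈⁅x⁆ _)

  -- Base case of Rado's argument: Hall's condition for singletons supplies a candidate, and for
  -- pairs it makes the choice injective.
  functional-matching : Matching R S
  functional-matching = record { match = choose ; match∈ = choose∈ ; matchInj = choose-injective }

Matching-mono : ∀ {R R′ : Fin n → VSet n} {S} → (∀ {a} → R a ⊆ R′ a) → Matching R S → Matching R′ S
Matching-mono R⊆R′ m = record { match = match ; match∈ = R⊆R′ ∘ match∈ ; matchInj = matchInj }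
  where open Matching m

-- While some `a` has two candidates, `uncross` lets one of them be deleted. The number of pairs in
-- `R`, bounded by the fuel, drops each time.
hall-matching : (R : Fin n → VSet n) (S : VSet n) → Hall R S → Matching R S
hall-matching {n} R S hall = go (suc (sum (card ∘ R))) R ≤-refl hall
  where
  go : ∀ k R → sum (card ∘ R) < k → Hall R S → Matching R S
  go zero    R () hall
  go (suc k) R lt hall
    with any? (λ a → any? (λ b₁ → any? (λ b₂ → (a ∈? S) ×-dec (b₁ ∈? R a) ×-dec (b₂ ∈? R a) ×-dec ¬? (b₁ ≟ b₂))))
  ... | no ¬branch = functional-matching R S hall λ {a} {b} {b′} a∈S b∈ b′∈ →
        decidable-stable (b ≟ b′) λ b≢b′ → ¬branch (a , b , b′ , a∈S , b∈ , b′∈ , b≢b′)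
  ... | yes (a , b₁ , b₂ , a∈S , b₁∈ , b₂∈ , b₁≢b₂)
    with Hall-or-violated (R without (a , b₁)) S | Hall-or-violated (R without (a , b₂)) S
  ... | inj₁ hall₁ | _ = Matching-mono (without⁻ R) (go k _ (<-≤-trans (total-without R b₁∈) (≤-pred lt)) hall₁)
  ... | inj₂ _ | inj₁ hall₂ = Matching-mono (without⁻ R) (go k _ (<-≤-trans (total-without R b₂∈) (≤-pred lt)) hall₂)
  ... | inj₂ v₁ | inj₂ v₂ = ⊥-elim (uncross R S hall b₁≢b₂ v₁ v₂)

-- The forbidden hexagon

record TriangleFree (n : ℕ) : Set where
  field
    N        : Fin n → VSet n
    N-sym    : ∀ {u v} → u ∈ N v → v ∈ N u
    triangle : ∀ {u v w} → u ∈ N v → v ∈ N w → u ∉ N w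

  -- Minimum degree above 10n/29 with denominators cleared; this is what Δ < 19n/29 - 1 becomes in
  -- the complement.
  Dense : Set
  Dense = ∀ v → 10 * n < 29 * card (N v)

  irreflexive : ∀ {v} → v ∉ N v
  irreflexive v∈ = triangle v∈ v∈ v∈

-- Known adjacencies of a sequence of vertices, newest first: each row tells which older vertices are
-- certainly adjacent to the new one.
data Rows : ℕ → Set where
  []  : Rows 0
  _∷_ : Vec Bool k → Rows k → Rows (suc k)

-- A certificate that no vertices realise the given rows. A weighting refutes them if no vertex can see
-- more than 10/29 of the total weight; elim S first refutes the existence of a vertex adjacent to all of S,
-- where vertices are numbered from the oldest one.
data Certificate : ℕ → Set where
  weigh : Vec ℕ k → Certificate k
  elim  : List ℕ → Certificate (suc k) → Certificate k → Certificate k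

-- Vectors list the newest vertex first while numbers count from the oldest, so the head of a vector
-- of length `suc k` belongs to vertex `k`.
row : (k : ℕ) → List ℕ → Vec Bool k
row zero    S = []
row (suc k) S = any (k ≡ᵇ_) S ∷ row k S

-- Entries `false` on the left demand nothing, so a proof is just the tuple of the required
-- adjacencies.
_⊑_ : Vec Bool k → Vec Bool k → Set
[]          ⊑ []      = ⊤
(true ∷ P)  ⊑ (b ∷ I) = b ≡ true × P ⊑ I
(false ∷ P) ⊑ (b ∷ I) = P ⊑ I

_⊑ᵇ_ : Vec Bool k → Vec Bool k → Bool
[]          ⊑ᵇ []      = true
(true ∷ P)  ⊑ᵇ (b ∷ I) = b ∧ P ⊑ᵇ I
(false ∷ P) ⊑ᵇ (b ∷ I) = P ⊑ᵇ I

∧⁻ : ∀ {a b} → a ∧ b ≡ true → a ≡ true × b ≡ true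
∧⁻ {true} e = refl , e

∨⁻ : ∀ {a b} → a ∨ b ≡ true → a ≡ true ⊎ b ≡ true
∨⁻ {true}  e = inj₁ refl
∨⁻ {false} e = inj₂ e

⊑ᵇ⇒⊑ : (P I : Vec Bool k) → P ⊑ᵇ I ≡ true → P ⊑ I
⊑ᵇ⇒⊑ []          []      e = tt
⊑ᵇ⇒⊑ (true ∷ P)  (b ∷ I) e = proj₁ (∧⁻ e) , ⊑ᵇ⇒⊑ P I (proj₂ (∧⁻ {b} e))
⊑ᵇ⇒⊑ (false ∷ P) (b ∷ I) e = ⊑ᵇ⇒⊑ P I e

Disjoint : Vec Bool k → Vec Bool k → Set
Disjoint []          []      = ⊤
Disjoint (true ∷ P)  (b ∷ I) = b ≡ false × Disjoint P I
Disjoint (false ∷ P) (b ∷ I) = Disjoint P I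

Disjoint-none : (I : Vec Bool k) → Disjoint (Vec.replicate k false) I
Disjoint-none []      = tt
Disjoint-none (_ ∷ I) = Disjoint-none I

Disjoint-∨ : (P Q I : Vec Bool k) → Disjoint P I → Disjoint Q I → Disjoint (Vec.zipWith _∨_ P Q) I
Disjoint-∨ []          []          []      d       e       = tt
Disjoint-∨ (true ∷ P)  (true ∷ Q)  (_ ∷ I) (b , d) (_ , e) = b , Disjoint-∨ P Q I d e
Disjoint-∨ (true ∷ P)  (false ∷ Q) (_ ∷ I) (b , d) e       = b , Disjoint-∨ P Q I d e
Disjoint-∨ (false ∷ P) (true ∷ Q)  (_ ∷ I) d       (b , e) = b , Disjoint-∨ P Q I d e
Disjoint-∨ (false ∷ P) (false ∷ Q) (_ ∷ I) d       e       = Disjoint-∨ P Q I d e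

-- Tests φ on all stable sets avoiding the blocked vertices.
allStable : Rows k → Vec Bool k → (Vec Bool k → Bool) → Bool
allStable []      []             φ = φ []
allStable (P ∷ R) (blocked ∷ bs) φ =
  allStable R bs (φ ∘ (false ∷_)) ∧ (blocked ∨ allStable R (Vec.zipWith _∨_ P bs) (φ ∘ (true ∷_)))

dot : Vec ℕ k → Vec Bool k → ℕ
dot []       []       = 0
dot (y ∷ ys) (b ∷ bs) = y * bit b + dot ys bs

-- `X` lists rows already known to be realised by no vertex, so a trace containing one of them needs
-- no weight bound.
light : List (Vec Bool k) → Vec ℕ k → Vec Bool k → Bool
light X ys I = any (_⊑ᵇ I) X ∨ (29 * dot ys I ≤ᵇ 10 * Vec.sum ys)

check : Rows k → List (Vec Bool k) → Certificate k → Bool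
check {k} R X (weigh ys)  = (1 ≤ᵇ Vec.sum ys) ∧ allStable R (Vec.replicate k false) (light X ys)
-- Old exclusions hold whatever the adjacency to the new vertex, hence the padding with `false`. In
-- the second check `row k S` has itself become an exclusion.
check {k} R X (elim S c d) = check (row k S ∷ R) (List.map (false ∷_) X) c ∧ check R (row k S ∷ X) d

-- Soundness of weighting certificates

module _ (H : TriangleFree n) where
  open TriangleFree H

  trace : Fin n → Vec (Fin n) k → Vec Bool k
  trace x = Vec.map λ v → char (N v) x

  -- The listed vertices may coincide and may have further adjacencies; a certificate refutes all
  -- these possibilities at once.
  Realises : Vec (Fin n) k → Rows k → Set
  Realises []       []      = ⊤
  Realises (v ∷ vs) (P ∷ R) = P ⊑ trace v vs × Realises vs R

  Excluded : Vec (Fin n) k → Vec Bool k → Set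
  Excluded vs P = ∀ x → ¬ P ⊑ trace x vs

  -- A common entry would close a triangle with `x` and `v`. Traces are therefore stable with
  -- respect to the known edges.
  disjoint-traces : ∀ {x v} (vs : Vec (Fin n) k) P → x ∈ N v → P ⊑ trace v vs → Disjoint P (trace x vs)
  disjoint-traces []       []          x∈ _       = tt
  disjoint-traces {x = x} {v} (u ∷ vs) (true ∷ P) x∈ (e , es) with char (N u) x in eq
  ... | true  = contradiction (mem eq) (triangle x∈ (mem e))
  ... | false = refl , disjoint-traces vs P x∈ es
  disjoint-traces (u ∷ vs) (false ∷ P) x∈ es       = disjoint-traces vs P x∈ es

  -- Follows the branch of the recursion that agrees with `trace x vs`; by `disjoint-traces` this
  -- branch never selects a blocked vertex.
  allStable-sound : ∀ {R : Rows k} bs φ x vs → Realises vs R → Disjoint bs (trace x vs) →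
                         allStable R bs φ ≡ true → φ (trace x vs) ≡ true
  allStable-sound {R = []}    []       φ x []       _        _ ok = ok
  allStable-sound {R = P ∷ R} (b ∷ bs) φ x (v ∷ vs) (p , rs) d ok with char (N v) x in eq
  allStable-sound {R = P ∷ R} (true  ∷ bs) φ x (v ∷ vs) (p , rs) (() , d) ok | true
  allStable-sound {R = P ∷ R} (false ∷ bs) φ x (v ∷ vs) (p , rs) d ok | true =
    allStable-sound _ (φ ∘ (true ∷_)) x vs rs
      (Disjoint-∨ P bs (trace x vs) (disjoint-traces vs P (mem eq) p) d) (proj₂ (∧⁻ ok))
  allStable-sound {R = P ∷ R} (true  ∷ bs) φ x (v ∷ vs) (p , rs) (_ , d) ok | false =
    allStable-sound bs (φ ∘ (false ∷_)) x vs rs d (proj₁ (∧⁻ ok))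
  allStable-sound {R = P ∷ R} (false ∷ bs) φ x (v ∷ vs) (p , rs) d ok | false =
    allStable-sound bs (φ ∘ (false ∷_)) x vs rs d (proj₁ (∧⁻ ok))

  weightedDegree : Vec ℕ k → Vec (Fin n) k → ℕ
  weightedDegree []       []       = 0
  weightedDegree (y ∷ ys) (v ∷ vs) = y * card (N v) + weightedDegree ys vs

  opaque
    unfolding card
    double-count : (ys : Vec ℕ k) (vs : Vec (Fin n) k) → sum (λ x → dot ys (trace x vs)) ≡ weightedDegree ys vs
    double-count []       []       = trans (sum-const n 0) (*-zeroʳ n)
    double-count (y ∷ ys) (v ∷ vs) = begin
      sum (λ x → y * bit (char (N v) x) + dot ys (trace x vs))
        ≡⟨ ∑-distrib-+ (λ x → y * bit (char (N v) x)) (λ x → dot ys (trace x vs)) ⟩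
      sum (λ x → y * bit (char (N v) x)) + sum (λ x → dot ys (trace x vs))
        ≡⟨ cong₂ _+_ (sym (*-distribˡ-sum y (λ x → bit (char (N v) x)))) (double-count ys vs) ⟩
      y * card (N v) + weightedDegree ys vs ∎
      where open ≡-Reasoning

  -- The extra summand `Vec.sum ys` records the strictness of `Dense`, gained once per unit of
  -- weight; `heavy` turns it into a strict inequality.
  weightedDegree-dense : Dense → (ys : Vec ℕ k) (vs : Vec (Fin n) k) →
                         Vec.sum ys + Vec.sum ys * (10 * n) ≤ 29 * weightedDegree ys vs
  weightedDegree-dense dense []       []       = z≤n
  weightedDegree-dense dense (y ∷ ys) (v ∷ vs) = begin
    Y′ + Y′ * (10 * n)                       ≡⟨ *-suc Y′ (10 * n) ⟨
    (y + Y) * suc (10 * n)                   ≡⟨ *-distribʳ-+ (suc (10 * n)) y Y ⟩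
    y * suc (10 * n) + Y * suc (10 * n)      ≤⟨ +-mono-≤ (*-monoʳ-≤ y (dense v)) (≤-trans (≤-reflexive (*-suc Y (10 * n))) (weightedDegree-dense dense ys vs)) ⟩
    y * (29 * d) + 29 * W                    ≡⟨ cong (_+ 29 * W) (trans (sym (*-assoc y 29 d)) (trans (cong (_* d) (*-comm y 29)) (*-assoc 29 y d))) ⟩
    29 * (y * d) + 29 * W                    ≡⟨ *-distribˡ-+ 29 (y * d) W ⟨
    29 * (y * d + W)                         ∎
    where
    open ≤-Reasoning
    Y = Vec.sum ys
    Y′ = y + Y
    d = card (N v)
    W = weightedDegree ys vs

  -- Averaging: the weighted vertices have degree above 10n/29, so a vertex chosen at random sees on
  -- average more than 10/29 of the total weight.
  heavy : Dense → (ys : Vec ℕ k) (vs : Vec (Fin n) k) → 1 ≤ Vec.sum ys →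
          ¬ (∀ x → 29 * dot ys (trace x vs) ≤ 10 * Vec.sum ys)
  heavy dense ys vs pos bound = <-irrefl refl (begin-strict
    Y * (10 * n)                             <⟨ m<n+m _ pos ⟩
    Y + Y * (10 * n)                         ≤⟨ weightedDegree-dense dense ys vs ⟩
    29 * weightedDegree ys vs                ≡⟨ cong (29 *_) (double-count ys vs) ⟨
    29 * sum (λ x → dot ys (trace x vs))     ≡⟨ *-distribˡ-sum 29 (λ x → dot ys (trace x vs)) ⟩
    sum (λ x → 29 * dot ys (trace x vs))     ≤⟨ sum-mono-≤ bound ⟩
    sum {n} (λ x → 10 * Y)                   ≡⟨ sum-const n (10 * Y) ⟩
    n * (10 * Y)                             ≡⟨ *-comm n (10 * Y) ⟩
    10 * Y * n                               ≡⟨ cong (_* n) (*-comm 10 Y) ⟩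
    Y * 10 * n                               ≡⟨ *-assoc Y 10 n ⟩
    Y * (10 * n)                             ∎)
    where
    open ≤-Reasoning
    Y = Vec.sum ys

  excluded-any : ∀ (X : List (Vec Bool k)) I → any (_⊑ᵇ I) X ≡ true → ¬ All (λ P → ¬ P ⊑ I) X
  excluded-any (P ∷ X) I e (¬P ∷ ¬X) = [ ¬P ∘ ⊑ᵇ⇒⊑ P I , (λ e′ → excluded-any X I e′ ¬X) ]′ (∨⁻ e)

  -- In the `elim` case, soundness of `c` applied to a hypothetical vertex realising `row _ S` is
  -- exactly the new exclusion that `d` may use.
  certificate-sound : Dense → ∀ {R : Rows k} {X} c vs → Realises vs R → All (Excluded vs) X →
                      check R X c ≢ true
  certificate-sound dense {R} {X} (weigh ys) vs rs ex ok = heavy dense ys vs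
    (≤ᵇ⇒≤ 1 _ (subst T (sym (proj₁ (∧⁻ ok))) tt))
    λ x → case ∨⁻ (allStable-sound _ (light X ys) x vs rs (Disjoint-none (trace x vs)) (proj₂ (∧⁻ {1 ≤ᵇ Vec.sum ys} ok))) of λ where
      (inj₁ e) → contradiction (All.map (λ ¬P → ¬P x) ex) (excluded-any X _ e)
      (inj₂ e) → ≤ᵇ⇒≤ _ _ (subst T (sym e) tt)
  certificate-sound dense {R} {X} (elim S c d) vs rs ex ok =
    certificate-sound dense d vs rs
      ((λ x p → certificate-sound dense c (x ∷ vs) (p , rs) (All.map⁺ (All.map (λ ¬P y → ¬P y) ex)) (proj₁ (∧⁻ ok))) ∷ ex)
      (proj₂ (∧⁻ {check (row _ S ∷ R) (List.map (false ∷_) X) c} ok))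

hexagonRows : Rows 6
hexagonRows = row 5 (0 ∷ 4 ∷ []) ∷ row 4 (3 ∷ []) ∷ row 3 (2 ∷ []) ∷ row 2 (1 ∷ []) ∷ row 1 (0 ∷ []) ∷ [] ∷ []

-- The hexagon 0…5, common neighbours 6, 7, 8 of its antipodal pairs, and a vertex 9 adjacent to 0, 2, 4.
tripodRows : Rows 10
tripodRows = row 9 (0 ∷ 2 ∷ 4 ∷ []) ∷ row 8 (2 ∷ 5 ∷ []) ∷ row 7 (1 ∷ 4 ∷ []) ∷ row 6 (0 ∷ 3 ∷ []) ∷ hexagonRows

-- Found by computer search; weights are listed newest vertex first.
tripodCertificate : Certificate 10
tripodCertificate =
  (elim (2 ∷ 5 ∷ 6 ∷ 7 ∷ [])
    (elim (1 ∷ 4 ∷ 6 ∷ [])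
      -- Each weighting of twelve vertices has total 29, so the bound allows a trace weight of at
      -- most 10.
      (weigh (2 ∷ 3 ∷ 2 ∷ 0 ∷ 2 ∷ 3 ∷ 2 ∷ 4 ∷ 2 ∷ 3 ∷ 3 ∷ 3 ∷ []))
    (elim (0 ∷ 3 ∷ 7 ∷ [])
      (weigh (2 ∷ 3 ∷ 2 ∷ 0 ∷ 3 ∷ 2 ∷ 2 ∷ 3 ∷ 3 ∷ 3 ∷ 2 ∷ 4 ∷ []))
    -- The weighted vertices 0, 1, 7, 4, 3, 6 again form a hexagon, and both its alternating triples
    -- have just been excluded. The next two blocks end likewise.
    (weigh (0 ∷ 0 ∷ 0 ∷ 1 ∷ 1 ∷ 0 ∷ 1 ∷ 1 ∷ 0 ∷ 1 ∷ 1 ∷ []))))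
  (elim (1 ∷ 4 ∷ 6 ∷ 8 ∷ [])
    (elim (2 ∷ 5 ∷ 6 ∷ [])
      (weigh (2 ∷ 2 ∷ 2 ∷ 2 ∷ 1 ∷ 3 ∷ 3 ∷ 3 ∷ 2 ∷ 4 ∷ 2 ∷ 3 ∷ []))
    (elim (0 ∷ 3 ∷ 8 ∷ [])
      (weigh (2 ∷ 3 ∷ 2 ∷ 3 ∷ 0 ∷ 2 ∷ 2 ∷ 3 ∷ 3 ∷ 3 ∷ 2 ∷ 4 ∷ []))
    (weigh (0 ∷ 0 ∷ 1 ∷ 0 ∷ 1 ∷ 1 ∷ 0 ∷ 1 ∷ 1 ∷ 0 ∷ 1 ∷ []))))
  (elim (0 ∷ 3 ∷ 7 ∷ 8 ∷ [])
    (elim (2 ∷ 5 ∷ 7 ∷ [])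
      (weigh (2 ∷ 1 ∷ 2 ∷ 2 ∷ 3 ∷ 2 ∷ 3 ∷ 3 ∷ 2 ∷ 4 ∷ 2 ∷ 3 ∷ []))
    (elim (1 ∷ 4 ∷ 8 ∷ [])
      (weigh (2 ∷ 1 ∷ 2 ∷ 3 ∷ 2 ∷ 2 ∷ 2 ∷ 4 ∷ 2 ∷ 3 ∷ 3 ∷ 3 ∷ []))
    (weigh (0 ∷ 0 ∷ 1 ∷ 1 ∷ 0 ∷ 1 ∷ 1 ∷ 0 ∷ 1 ∷ 1 ∷ 0 ∷ []))))
  -- Of the vertices 0 to 8 some vertex must see four, as 3/9 < 10/29. The only stable quadruples
  -- are the three excluded ones: an antipodal pair with the chosen common neighbours of the other
  -- two pairs.
  (weigh (0 ∷ 1 ∷ 1 ∷ 1 ∷ 1 ∷ 1 ∷ 1 ∷ 1 ∷ 1 ∷ 1 ∷ [])))))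

tripod-ok : check tripodRows [] tripodCertificate ≡ true
tripod-ok = refl

module _ (H : TriangleFree n) where
  open TriangleFree H

  record Hexagon (a b c d e f : Fin n) : Set where
    constructor hexagon
    field
      ab : b ∈ N a
      bc : c ∈ N b
      cd : d ∈ N c
      de : e ∈ N d
      ef : f ∈ N e
      fa : a ∈ N f

  rotate : ∀ {a b c d e f} → Hexagon a b c d e f → Hexagon b c d e f a
  rotate (hexagon ab bc cd de ef fa) = hexagon bc cd de ef fa ab

  no-tripod : Dense → ∀ {a b c d e f} → Hexagon a b c d e f →
    ∀ {u v w x} → u ∈ N a → u ∈ N d → v ∈ N b → v ∈ N e → w ∈ N c → w ∈ N f →
    x ∈ N a → x ∈ N c → x ∉ N e
  no-tripod dense {a} {b} {c} {d} {e} {f} (hexagon ab bc cd de ef fa) {u} {v} {w} {x} ua ud vb ve wc wf xa xc xe =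
    certificate-sound H dense {R = tripodRows} tripodCertificate (x ∷ w ∷ v ∷ u ∷ f ∷ e ∷ d ∷ c ∷ b ∷ a ∷ [])
      ( (holds xe , holds xc , holds xa , tt)
      , (holds wf , holds wc , tt)
      , (holds ve , holds vb , tt)
      , (holds ud , holds ua , tt)
      , (holds ef , holds (N-sym fa) , tt)
      , (holds de , tt) , (holds cd , tt) , (holds bc , tt) , (holds ab , tt) , tt , tt)
      [] tripod-ok

  -- With unit weights some vertex sees three of the six, as 2/6 < 10/29. These form an alternating
  -- triple, and `no-tripod` excludes both such triples.
  no-hexagon : Dense → (∀ {u v} → u ∉ N v → ∃ λ w → w ∈ N u × w ∈ N v) →
    ∀ {a b c d e f} → Hexagon a b c d e f → a ∉ N d → b ∉ N e → c ∉ N f → ⊥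
  no-hexagon dense common {a} {b} {c} {d} {e} {f} h@(hexagon ab bc cd de ef fa) ad be cf =
    let u , ua , ud = common ad
        v , vb , ve = common be
        w , wc , wf = common cf
    in certificate-sound H dense {R = hexagonRows} {X = row 6 (0 ∷ 2 ∷ 4 ∷ []) ∷ row 6 (1 ∷ 3 ∷ 5 ∷ []) ∷ []}
      (weigh (1 ∷ 1 ∷ 1 ∷ 1 ∷ 1 ∷ 1 ∷ [])) (f ∷ e ∷ d ∷ c ∷ b ∷ a ∷ [])
      ((holds ef , holds (N-sym fa) , tt)
      , (holds de , tt) , (holds cd , tt) , (holds bc , tt) , (holds ab , tt) , tt , tt)
      ( (λ x (xe , xc , xa , _) → no-tripod dense h ua ud vb ve wc wf (mem xa) (mem xc) (mem xe))
      ∷ (λ x (xf , xd , xb , _) → no-tripod dense (rotate h) vb ve wc wf ud ua (mem xb) (mem xd) (mem xf))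
      ∷ []) refl

-- Dense triangle-free graphs

module _ (H : TriangleFree n) where
  open TriangleFree H

  Stable : VSet n → Set
  Stable I = ∀ {x y} → x ∈ I → y ∈ I → x ∉ N y

  neighbourhood-stable : ∀ v → Stable (N v)
  neighbourhood-stable v x∈ y∈ xy = triangle xy y∈ x∈

  edge-or-stable : ∀ I → (∃₂ λ x y → x ∈ I × y ∈ I × x ∈ N y) ⊎ Stable I
  edge-or-stable I with any? (λ x → any? (λ y → (x ∈? I) ×-dec (y ∈? I) ×-dec (x ∈? N y)))
  ... | yes e = inj₁ e
  ... | no ¬e = inj₂ λ x∈ y∈ xy → ¬e (_ , _ , x∈ , y∈ , xy)

  disjoint-neighbourhoods : ∀ {x y z} → x ∈ N y → z ∈ N x → z ∉ N y
  disjoint-neighbourhoods xy zx = triangle zx xy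

  infixl 8 _↾_
  _↾_ : (Fin n → VSet n) → VSet n → Fin n → VSet n
  (R ↾ J) a = R a ∩ J

  -- Replacing the neighbours of `Q` in `J` by `Q` itself gives a stable set, which cannot be larger
  -- than `J`.
  exchange : ∀ {J} → Stable J → (∀ I → Stable I → card I ≤ card J) →
             ∀ Q → Stable Q → (∀ x → x ∈ Q → x ∉ J) → card Q ≤ card (image (N ↾ J) Q)
  exchange {J} indJ max Q indQ Q∩J = +-cancelˡ-≤ (card rest) _ _ (begin
      card rest + card Q                 ≡⟨ card-∪-disjoint (λ x x∈rest x∈Q → Q∩J x x∈Q (proj₁ (∩⁻ x∈rest))) ⟨
      card (rest ∪ Q)                    ≤⟨ max (rest ∪ Q) ind ⟩
      card J                             ≤⟨ cover-≤ split ⟩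
      card rest + card (image (N ↾ J) Q) ∎)
    where
    open ≤-Reasoning
    rest : VSet n
    rest = J ∩ ∁ (image (N ↾ J) Q)
    split : ∀ x → x ∈ J → x ∈ rest ⊎ x ∈ image (N ↾ J) Q
    split x x∈J = case x ∈? image (N ↾ J) Q of λ where
      (yes x∈) → inj₂ x∈
      (no x∉)  → inj₁ (∩⁺ x∈J (∁⁺ x∉))
    no-edge : ∀ {x y} → x ∈ rest → y ∈ Q → x ∉ N y
    no-edge x∈ y∈ xy = ∁⁻ (proj₂ (∩⁻ x∈)) (image⁺ y∈ (∩⁺ xy (proj₁ (∩⁻ x∈))))
    ind : Stable (rest ∪ Q)
    ind x∈ y∈ xy with ∪⁻ x∈ | ∪⁻ y∈
    ... | inj₁ x∈r | inj₁ y∈r = indJ (proj₁ (∩⁻ x∈r)) (proj₁ (∩⁻ y∈r)) xy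
    ... | inj₁ x∈r | inj₂ y∈q = no-edge x∈r y∈q xy
    ... | inj₂ x∈q | inj₁ y∈r = no-edge y∈r x∈q (N-sym xy)
    ... | inj₂ x∈q | inj₂ y∈q = indQ x∈q y∈q xy

  module _ (dense : Dense) where

    -- Since 3 · 10 > 29, three neighbourhoods are too large to be pairwise disjoint.
    three-degrees : ∀ a b c → n < card (N a) + card (N b) + card (N c)
    three-degrees a b c = *-cancelˡ-< 29 n _ (begin-strict
        29 * n                       ≤⟨ *-monoˡ-≤ n (m≤m+n 29 1) ⟩
        30 * n                       ≡⟨ solve 1 (λ n → con 30 :* n := con 10 :* n :+ con 10 :* n :+ con 10 :* n) refl n ⟩
        10 * n + 10 * n + 10 * n     <⟨ +-mono-< (+-mono-< (dense a) (dense b)) (dense c) ⟩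
        29 * A + 29 * B + 29 * C     ≡⟨ solve 3 (λ A B C → con 29 :* A :+ con 29 :* B :+ con 29 :* C := con 29 :* (A :+ B :+ C)) refl A B C ⟩
        29 * (A + B + C)             ∎)
      where
      open ≤-Reasoning
      open +-*-Solver using (solve; con; _:=_; _:+_; _:*_)
      A = card (N a)
      B = card (N b)
      C = card (N c)

    -- For stable `Q` this is `exchange`. An edge of `Q` gives two disjoint neighbourhoods inside
    -- `im` and `U`; a violation leaves some `x` in `J` without neighbours in `Q`, so `N x` fits
    -- into `U` beside `Q`. Together the three degrees stay within n.
    hall-into-stable : ∀ {J} → Stable J → (∀ I → Stable I → card I ≤ card J) →
                            card (∁ J) ≤ card J → Hall (N ↾ J) (∁ J)
    hall-into-stable {J} indJ max U≤J Q Q⊆U with edge-or-stable Q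
    ... | inj₂ indQ = exchange indJ max Q indQ λ x x∈Q → ∁⁻ (Q⊆U x∈Q)
    ... | inj₁ (q , q′ , q∈Q , q′∈Q , qq′) = ≮⇒≥ λ im<Q →
      let x , x∈J , x∉im = witness im J (<-≤-trans im<Q (≤-trans (card-⊆ Q⊆U) U≤J))
      in <-irrefl refl (begin-strict
        card U + card J                                                ≡⟨ trans (+-comm (card U) (card J)) (card-∁ J) ⟩
        n                                                              <⟨ three-degrees q q′ x ⟩
        card (N q) + card (N q′) + card (N x)                          ≤⟨ +-monoˡ-≤ (card (N x)) first ⟩
        card im + card U + card (N x)                                  ≤⟨ +-monoˡ-≤ (card (N x)) (+-monoˡ-≤ (card U) (<⇒≤ im<Q)) ⟩
        card Q + card U + card (N x)                                   ≡⟨ solve 3 (λ a b c → a :+ b :+ c := b :+ (c :+ a)) refl (card Q) (card U) (card (N x)) ⟩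
        card U + (card (N x) + card Q)                                 ≤⟨ +-monoʳ-≤ (card U) (second x x∈J x∉im) ⟩
        card U + card U                                                ≤⟨ +-monoʳ-≤ (card U) U≤J ⟩
        card U + card J                                                ∎)
      where
      open ≤-Reasoning
      open +-*-Solver using (solve; con; _:=_; _:+_; _:*_)
      U im : VSet n
      U = ∁ J
      im = image (N ↾ J) Q
      covered : ∀ {q x} → q ∈ Q → x ∈ N q → x ∈ im ⊎ x ∈ U
      covered {x = x} q∈Q xq = case x ∈? J of λ where
        (yes x∈J) → inj₁ (image⁺ q∈Q (∩⁺ xq x∈J))
        (no x∉J)  → inj₂ (∁⁺ x∉J)
      first : card (N q) + card (N q′) ≤ card im + card U
      first = ≤-trans (≤-reflexive (sym (card-∪-disjoint λ x → disjoint-neighbourhoods qq′)))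
                      (cover-≤ λ x x∈ → [ covered q∈Q , covered q′∈Q ]′ (∪⁻ x∈))
      second : ∀ x → x ∈ J → x ∉ im → card (N x) + card Q ≤ card U
      second x x∈J x∉im = disjoint-≤ (λ y yx y∈Q → x∉im (image⁺ y∈Q (∩⁺ (N-sym yx) x∈J)))
                                     (λ yx → ∁⁺ λ y∈J → indJ y∈J x∈J yx) Q⊆U

    -- Let `R` be the part of `U` with no neighbour in a violating `Q`. If `R` has an edge, the
    -- neighbourhoods of its ends are disjoint from each other and from `Q`, and `Q` is larger than
    -- `N q`, against `three-degrees`. Otherwise `Q ∪ R` is stable and at least as large as `U`,
    -- hence too large.
    hall-from-stable : (∀ I → Stable I → card I + card I < n) → ∀ {J} → Stable J → Hall (N ↾ ∁ J) J
    hall-from-stable small {J} indJ Q Q⊆J = ≮⇒≥ λ im<Q →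
      let q , q∈Q = member Q (≤-<-trans z≤n im<Q) in case edge-or-stable R of λ where
        (inj₁ (r , r′ , r∈R , r′∈R , rr′)) → <⇒≱ (three-degrees r r′ q) (begin
          card (N r) + card (N r′) + card (N q)  ≤⟨ +-monoʳ-≤ (card (N r) + card (N r′)) (≤-trans (card-⊆ (from q∈Q)) (<⇒≤ im<Q)) ⟩
          card (N r) + card (N r′) + card Q      ≡⟨ cong (_+ card Q) (card-∪-disjoint λ x → disjoint-neighbourhoods rr′) ⟨
          card (N r ∪ N r′) + card Q             ≡⟨ card-∪-disjoint (λ x x∈ x∈Q → [ avoids r∈R x∈Q , avoids r′∈R x∈Q ]′ (∪⁻ x∈)) ⟨
          card ((N r ∪ N r′) ∪ Q)                ≤⟨ card-≤ _ ⟩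
          n                                      ∎)
        (inj₂ indR) → <-irrefl refl (begin-strict
          card J + card U                        ≡⟨ card-∁ J ⟩
          n                                      ≤⟨ n≤2U ⟩
          card U + card U                        ≤⟨ +-mono-≤ (U≤I im<Q) (U≤I im<Q) ⟩
          card (Q ∪ R) + card (Q ∪ R)            <⟨ small (Q ∪ R) (ind indR) ⟩
          n                                      ≡⟨ card-∁ J ⟨
          card J + card U                        ∎)
      where
      open ≤-Reasoning
      U im R : VSet n
      U = ∁ J
      im = image (N ↾ U) Q
      R = U ∩ ∁ im
      from : ∀ {q} → q ∈ Q → N q ⊆ im
      from q∈Q xq = image⁺ q∈Q (∩⁺ xq (∁⁺ λ x∈J → indJ x∈J (Q⊆J q∈Q) xq))
      avoids : ∀ {r x} → r ∈ R → x ∈ Q → x ∉ N r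
      avoids r∈R x∈Q xr = ∁⁻ (proj₂ (∩⁻ r∈R)) (from x∈Q (N-sym xr))
      ind : Stable R → Stable (Q ∪ R)
      ind indR x∈ y∈ xy with ∪⁻ x∈ | ∪⁻ y∈
      ... | inj₁ x∈q | inj₁ y∈q = indJ (Q⊆J x∈q) (Q⊆J y∈q) xy
      ... | inj₁ x∈q | inj₂ y∈r = avoids y∈r x∈q xy
      ... | inj₂ x∈r | inj₁ y∈q = avoids x∈r y∈q (N-sym xy)
      ... | inj₂ x∈r | inj₂ y∈r = indR x∈r y∈r xy
      U≤I : card im < card Q → card U ≤ card (Q ∪ R)
      U≤I im<Q = begin
        card U              ≡⟨ card-split U im ⟨
        card (U ∩ im) + card R ≤⟨ +-monoˡ-≤ (card R) (≤-trans (card-⊆ (proj₂ ∘ ∩⁻)) (<⇒≤ im<Q)) ⟩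
        card Q + card R     ≡⟨ card-∪-disjoint (λ x x∈Q x∈R → ∁⁻ (proj₁ (∩⁻ x∈R)) (Q⊆J x∈Q)) ⟨
        card (Q ∪ R)        ∎
      n≤2U : n ≤ card U + card U
      n≤2U = begin
        n                   ≡⟨ card-∁ J ⟨
        card J + card U     ≤⟨ +-monoˡ-≤ (card U) (<⇒≤ (+-cancelˡ-< (card J) _ _ (<-≤-trans (small J indJ) (≤-reflexive (sym (card-∁ J)))))) ⟩
        card U + card U     ∎

    -- Stable sets and neighbourhoods at diameter two

    module _ (common : ∀ {u v} → u ∉ N v → ∃ λ w → w ∈ N u × w ∈ N v) where

      -- For `y` outside `N w`, the traces on `N w` of the neighbours of `y` are linearly ordered by
      -- inclusion: incomparable ones close the hexagon w, x, u, y, u′, x′.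
      chain : ∀ {w y u u′ x x′} → y ∉ N w → u ∈ N y → u′ ∈ N y →
              x ∈ N w → x ∈ N u → x ∉ N u′ → x′ ∈ N w → x′ ∈ N u′ → x′ ∈ N u
      chain {u = u} {x′ = x′} yw uy u′y xw xu xu′ x′w x′u′ = decidable-stable (x′ ∈? N u) λ x′u →
        no-hexagon H dense common (hexagon xw (N-sym xu) (N-sym uy) u′y x′u′ (N-sym x′w))
          (yw ∘ N-sym) xu′ (x′u ∘ N-sym)

      -- Let `w` see as much of `I` as possible and miss `y` in `I`. By `chain`, the neighbour `u`
      -- of `y` with the largest trace on `N w ∩ I` sees all of that set, and `y` too, contradicting
      -- the choice of `w`.
      helly : Fin n → ∀ I → Stable I → ∃ λ u → I ⊆ N u
      helly v₀ I ind with argmax (λ _ → yes tt) (λ u → card (N u ∩ I)) n (λ u → card-≤ _) (v₀ , tt)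
      ... | w , _ , w-max with any? (λ y → (y ∈? I) ×-dec ¬? (y ∈? N w))
      ... | no ¬y = w , λ {x} x∈I → decidable-stable (x ∈? N w) λ x∉ → ¬y (x , x∈I , x∉)
      ... | yes (y , y∈I , yw)
        with argmax (λ u → u ∈? N y) (λ u → card (N u ∩ (N w ∩ I))) n (λ u → card-≤ _)
                    -- A common neighbour of `y` with itself is simply some neighbour of `y`.
                    (let u , uy , _ = common {y} {y} irreflexive in u , uy)
      ... | u , uy , u-max = contradiction (w-max u tt) (<⇒≱ (card-⊂ (λ x∈ → ∩⁺ (all x∈) (proj₂ (∩⁻ x∈)))
                               (∩⁺ (N-sym uy) y∈I) (yw ∘ proj₁ ∘ ∩⁻)))
        where
        all : ∀ {x} → x ∈ N w ∩ I → x ∈ N u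
        all {x} x∈ = decidable-stable (x ∈? N u) λ xu →
          let xw , x∈I = ∩⁻ x∈
              u′ , u′x , u′y = common (ind x∈I y∈I)
          in <⇒≱ (card-⊂ {p = N u ∩ (N w ∩ I)} {q = N u′ ∩ (N w ∩ I)}
                   (λ x′∈ → let x′u , x′wI = ∩⁻ x′∈
                            in ∩⁺ (chain yw u′y uy xw (N-sym u′x) xu (proj₁ (∩⁻ x′wI)) x′u) x′wI)
                   (∩⁺ (N-sym u′x) x∈) (xu ∘ proj₁ ∘ ∩⁻))
                 (u-max u′ u′y)

      -- By `minimal`, among the vertices outside `N w` that have a neighbour outside `N w`, `r` has
      -- the fewest neighbours in `N w`.
      module _ {w r s a : Fin n} (r∉ : r ∉ N w) (s∈ : s ∈ N w) (sr : s ∈ N r) (ar : a ∈ N r) (a∉ : a ∉ N w)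
        (minimal : ∀ t b → t ∉ N w → b ∉ N w → b ∈ N t → card (N w ∩ ∁ (N t)) ≤ card (N w ∩ ∁ (N r))) where

        -- The common neighbour `b` outside `N w` makes the traces of `r` and `t` on `N w`
        -- comparable by `chain`, and `minimal` decides the direction.
        inherits : ∀ {t b x} → t ∉ N w → b ∉ N w → b ∈ N r → b ∈ N t → x ∈ N w → x ∈ N r → x ∈ N t
        inherits {t} {b} {x} t∉ b∉ br bt xw xr = decidable-stable (x ∈? N t) λ xt →
          <⇒≱ (card-⊂ (λ y∈ → let yw , yr = ∩⁻ y∈ in ∩⁺ yw (∁⁺ λ yt →
                        ∁⁻ yr (chain b∉ (N-sym br) (N-sym bt) xw xr xt yw yt)))
                      (∩⁺ xw (∁⁺ xt)) (λ x∈ → ∁⁻ (proj₂ (∩⁻ x∈)) xr))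
              (minimal t b t∉ b∉ bt)

        -- A common neighbour of `z` and `s` is adjacent to `s` and so lies outside the stable set
        -- `N w`.
        outer-neighbour : ∀ {z} → z ∉ N s → ∃ λ b → b ∈ N z × b ∉ N w
        outer-neighbour {z} zs with any? (λ b → (b ∈? N z) ×-dec ¬? (b ∈? N w))
        ... | yes b = b
        ... | no ¬b = let p , pz , ps = common zs in
          contradiction (p , pz , λ pw → neighbourhood-stable w pw s∈ ps) ¬b

        -- If `z` is not adjacent to `r`, neighbours `b` of `z` and `a` of `r` outside `N w` extend
        -- to the forbidden hexagon a, p, z, b, q, r with `p` and `q` in `N w`.
        dominated : ∀ z → z ∉ N w → z ∉ N s → z ∈ N r
        dominated z z∉ zs = decidable-stable (z ∈? N r) λ zr →
          let b , bz , b∉ = outer-neighbour zs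
              y , yr , yz = common (zr ∘ N-sym)
              -- Through a common neighbour outside `N w`, `z` would inherit the neighbour `s` of
              -- `r`.
              inner : ∀ {c} → c ∈ N r → c ∈ N z → c ∈ N w
              inner {c} cr cz = decidable-stable (c ∈? N w) λ c∉ → zs (N-sym (inherits z∉ c∉ cr cz s∈ sr))
              yw = inner yr yz
              -- If `c` and `d` were adjacent, `d` would inherit the neighbour `y` of `r`, and d, z,
              -- y would be a triangle.
              far : ∀ {c d} → c ∈ N r → c ∉ N w → d ∉ N w → d ∈ N z → d ∉ N c
              far cr c∉ d∉ dz dc = triangle dz (N-sym yz) (N-sym (inherits d∉ c∉ cr (N-sym dc) yw yr))
              p , pa , pz = common {a} {z} (λ az → a∉ (inner ar az))
              pw : p ∈ N w
              pw = decidable-stable (p ∈? N w) λ p∉ → far ar a∉ p∉ pz pa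
              q , qb , qr = common {b} {r} (λ br → b∉ (inner br bz))
              qw : q ∈ N w
              qw = decidable-stable (q ∈? N w) λ q∉ → far qr q∉ b∉ bz (N-sym qb)
          in no-hexagon H dense common
               (hexagon pa (N-sym pz) bz qb (N-sym qr) ar)
               (λ ab → far ar a∉ b∉ bz (N-sym ab)) (neighbourhood-stable w pw qw) zr

-- Maximal triangle-free graphs

open TriangleFree

_≼_ : TriangleFree n → TriangleFree n → Set
H ≼ H′ = ∀ {v} → N H v ⊆ N H′ v

-- Distance at most two. Distinct vertices are close just when they are adjacent or joining them
-- would create a triangle.
Close : TriangleFree n → Fin n → Fin n → Set
Close H a b = a ≡ b ⊎ (a ∈ N H b ⊎ ∃ λ w → w ∈ N H a × w ∈ N H b)

Close-mono : {H H′ : TriangleFree n} → H ≼ H′ → ∀ {a b} → Close H a b → Close H′ a b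
Close-mono ≼ (inj₁ eq)                     = inj₁ eq
Close-mono ≼ (inj₂ (inj₁ ab))              = inj₂ (inj₁ (≼ ab))
Close-mono ≼ (inj₂ (inj₂ (w , wa , wb))) = inj₂ (inj₂ (w , ≼ wa , ≼ wb))

module _ (H : TriangleFree n) (a b : Fin n) (a≢b : a ≢ b) (far : ∀ w → w ∈ N H a → w ∉ N H b) where

  private
    New : Fin n → Fin n → Set
    New v u = (u ≡ a × v ≡ b) ⊎ (u ≡ b × v ≡ a)

    new? : ∀ v u → Dec (New v u)
    new? v u = ((u ≟ a) ×-dec (v ≟ b)) ⊎-dec ((u ≟ b) ×-dec (v ≟ a))

    N′ : Fin n → VSet n
    N′ v = N H v ∪ ｛ new? v ｝

    cases : ∀ {u v} → u ∈ N′ v → u ∈ N H v ⊎ New v u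
    cases u∈ = [ inj₁ , inj₂ ∘ ｛｝⁻ _ ]′ (∪⁻ u∈)

    new-sym : ∀ {u v} → New v u → New u v
    new-sym (inj₁ (p , q)) = inj₂ (q , p)
    new-sym (inj₂ (p , q)) = inj₁ (q , p)

    -- If the other two sides are old, their common vertex contradicts `far`; if one of them is new
    -- as well, the triangle degenerates to a loop or to `a ≡ b`.
    new-triangle : ∀ {u v w} → New v u → v ∈ N′ w → u ∉ N′ w
    new-triangle {w = w} vu vw uw with cases vw | cases uw
    new-triangle (inj₁ (refl , refl)) vw uw | inj₁ bw | inj₁ aw = far _ (N-sym H aw) (N-sym H bw)
    new-triangle (inj₂ (refl , refl)) vw uw | inj₁ aw | inj₁ bw = far _ (N-sym H aw) (N-sym H bw)
    new-triangle (inj₁ (refl , refl)) vw uw | inj₁ bw | inj₂ (inj₁ (_ , refl)) = irreflexive H bw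
    new-triangle (inj₁ (refl , refl)) vw uw | inj₁ bw | inj₂ (inj₂ (refl , _)) = a≢b refl
    new-triangle (inj₂ (refl , refl)) vw uw | inj₁ aw | inj₂ (inj₁ (refl , _)) = a≢b refl
    new-triangle (inj₂ (refl , refl)) vw uw | inj₁ aw | inj₂ (inj₂ (_ , refl)) = irreflexive H aw
    new-triangle (inj₁ (refl , refl)) vw uw | inj₂ (inj₁ (refl , _)) | _ = a≢b refl
    new-triangle (inj₁ (refl , refl)) vw uw | inj₂ (inj₂ (_ , refl)) | inj₁ aw = irreflexive H aw
    new-triangle (inj₁ (refl , refl)) vw uw | inj₂ (inj₂ (_ , refl)) | inj₂ (inj₁ (_ , refl)) = a≢b refl
    new-triangle (inj₁ (refl , refl)) vw uw | inj₂ (inj₂ (_ , refl)) | inj₂ (inj₂ (refl , _)) = a≢b refl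
    new-triangle (inj₂ (refl , refl)) vw uw | inj₂ (inj₂ (refl , _)) | _ = a≢b refl
    new-triangle (inj₂ (refl , refl)) vw uw | inj₂ (inj₁ (_ , refl)) | inj₁ bw = irreflexive H bw
    new-triangle (inj₂ (refl , refl)) vw uw | inj₂ (inj₁ (_ , refl)) | inj₂ (inj₁ (refl , _)) = a≢b refl
    new-triangle (inj₂ (refl , refl)) vw uw | inj₂ (inj₁ (_ , refl)) | inj₂ (inj₂ (_ , refl)) = a≢b refl

    sym′ : ∀ {u v} → u ∈ N′ v → v ∈ N′ u
    sym′ u∈ = [ ∪⁺ˡ ∘ N-sym H , ∪⁺ʳ ∘ ｛｝⁺ _ ∘ new-sym ]′ (cases u∈)

    triangle′ : ∀ {u v w} → u ∈ N′ v → v ∈ N′ w → u ∉ N′ w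
    triangle′ uv vw uw with cases uv | cases vw | cases uw
    ... | inj₂ new | _ | _ = new-triangle new vw uw
    ... | _ | inj₂ new | _ = new-triangle new (sym′ uw) (sym′ uv)
    ... | _ | _ | inj₂ new = new-triangle new (sym′ vw) uv
    ... | inj₁ uv′ | inj₁ vw′ | inj₁ uw′ = triangle H uv′ vw′ uw′

  add-edge : ∃ λ H′ → H ≼ H′ × Close H′ a b
  add-edge = record { N = N′ ; N-sym = sym′ ; triangle = triangle′ } , ∪⁺ˡ ,
             inj₂ (inj₁ (∪⁺ʳ (｛｝⁺ _ (inj₁ (refl , refl)))))

close-up : (H : TriangleFree n) (a b : Fin n) → ∃ λ H′ → H ≼ H′ × Close H′ a b
close-up H a b with a ≟ b | any? (λ w → (w ∈? N H a) ×-dec (w ∈? N H b))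
... | yes eq | _      = H , id , inj₁ eq
... | no _   | yes w  = H , id , inj₂ (inj₂ w)
... | no a≢b | no far = add-edge H a b a≢b λ w wa wb → far (w , wa , wb)

-- One pass over the pairs suffices, because closeness once achieved survives later additions.
close-up-all : (L : List (Fin n × Fin n)) (H : TriangleFree n) →
               ∃ λ H′ → H ≼ H′ × All (λ (a , b) → Close H′ a b) L
close-up-all []            H = H , id , []
close-up-all ((a , b) ∷ L) H =
  let H₁ , H≼H₁ , ab = close-up H a b
      H₂ , H₁≼H₂ , rest = close-up-all L H₁
  in H₂ , H₁≼H₂ ∘ H≼H₁ , Close-mono {H = H₁} {H₂} H₁≼H₂ ab ∷ rest

maximal : (H : TriangleFree n) → ∃ λ H′ → H ≼ H′ × ∀ a b → Close H′ a b
maximal {n} H =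
  let H′ , H≼H′ , all = close-up-all (cartesianProduct (allFin n) (allFin n)) H
  in H′ , H≼H′ , λ a b → All.lookup all (∈-cartesianProduct⁺ (∈-allFin a) (∈-allFin b))

≼-Dense : {H H′ : TriangleFree n} → H ≼ H′ → Dense H → Dense H′
≼-Dense ≼ dense v = <-≤-trans (dense v) (*-monoʳ-≤ 29 (card-⊆ ≼))

has-neighbour : (H : TriangleFree n) → Dense H → ∀ v → ∃ λ w → w ∈ N H v
has-neighbour H dense v = member (N H v) (*-cancelˡ-< 29 0 _ (≤-<-trans z≤n (dense v)))

diameter-2 : (H : TriangleFree n) → Dense H → (∀ a b → Close H a b) →
             ∀ {u v} → u ∉ N H v → ∃ λ w → w ∈ N H u × w ∈ N H v
diameter-2 H dense close {u} {v} uv with close u v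
-- For equal vertices any neighbour is common, and density provides one.
... | inj₁ refl        = let w , wu = has-neighbour H dense u in w , wu , wu
... | inj₂ (inj₁ uv′)  = contradiction uv′ uv
... | inj₂ (inj₂ w)    = w

-- Complements and colourings

open Matching

enumerate : (f : Fin n → Bool) → Fin (sum (bit ∘ f)) → Fin n
enumerate {suc n} f i with f zero
enumerate {suc n} f zero    | true  = zero
enumerate {suc n} f (suc i) | true  = suc (enumerate (f ∘ suc) i)
enumerate {suc n} f i       | false = suc (enumerate (f ∘ suc) i)

enumerate-true : (f : Fin n → Bool) (i : Fin (sum (bit ∘ f))) → f (enumerate f i) ≡ true
enumerate-true {suc n} f i with f zero in eq
enumerate-true {suc n} f zero    | true  = eq
enumerate-true {suc n} f (suc i) | true  = enumerate-true (f ∘ suc) i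
enumerate-true {suc n} f i       | false = enumerate-true (f ∘ suc) i

enumerate-injective : (f : Fin n → Bool) {i j : Fin (sum (bit ∘ f))} → enumerate f i ≡ enumerate f j → i ≡ j
enumerate-injective {suc n} f {i} {j} e with f zero
enumerate-injective {suc n} f {zero}  {zero}  e | true  = refl
enumerate-injective {suc n} f {suc i} {suc j} e | true  = cong suc (enumerate-injective (f ∘ suc) (Fin.suc-injective e))
enumerate-injective {suc n} f {i}     {j}     e | false = enumerate-injective (f ∘ suc) (Fin.suc-injective e)

enumerate-onto : (f : Fin n → Bool) (x : Fin n) → f x ≡ true → ∃ λ i → enumerate f i ≡ x
enumerate-onto {suc n} f x e with f zero in eq
enumerate-onto {suc n} f zero    e | true  = zero , refl
enumerate-onto {suc n} f (suc x) e | true  = let i , p = enumerate-onto (f ∘ suc) x e in suc i , cong suc p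
enumerate-onto {suc n} f zero    e | false with () ← trans (sym e) eq
enumerate-onto {suc n} f (suc x) e | false = let i , p = enumerate-onto (f ∘ suc) x e in i , cong suc p

opaque
  unfolding card
  element : (p : VSet n) → Fin (card p) → Fin n
  element p = enumerate (char p)

  element∈ : (p : VSet n) (i : Fin (card p)) → element p i ∈ p
  element∈ p i = mem (enumerate-true (char p) i)

  element-injective : (p : VSet n) {i j : Fin (card p)} → element p i ≡ element p j → i ≡ j
  element-injective p = enumerate-injective (char p)

  rank : (p : VSet n) {x : Fin n} → x ∈ p → ∃ λ i → element p i ≡ x
  rank p {x} x∈p = enumerate-onto (char p) x (holds x∈p)

  card-tabulate : (f : Fin n → Bool) → Subset.∣ tabulate f ∣ ≡ card (set f)
  card-tabulate {zero}  f = refl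
  card-tabulate {suc n} f with f zero
  ... | true  = cong suc (card-tabulate (f ∘ suc))
  ... | false = card-tabulate (f ∘ suc)

rank-injective : {p : VSet n} {x y : Fin n} (x∈p : x ∈ p) (y∈p : y ∈ p) →
                 proj₁ (rank p x∈p) ≡ proj₁ (rank p y∈p) → x ≡ y
rank-injective {p = p} x∈p y∈p e = trans (sym (proj₂ (rank p x∈p))) (trans (cong (element p) e) (proj₂ (rank p y∈p)))

module _ (G : Graph n) where

  NonAdjacent : Fin n → Fin n → Set
  NonAdjacent v u = u ≢ v × adj G u v ≡ false

  nonAdjacent? : ∀ v u → Dec (NonAdjacent v u)
  nonAdjacent? v u = ¬? (u ≟ v) ×-dec (adj G u v Bool.≟ false)

  no-independent-triple : IndependenceNumber G 2 → ∀ {u v w} → NonAdjacent v u → NonAdjacent w v → ¬ NonAdjacent w u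
  no-independent-triple (_ , ≤2) {u} {v} {w} (u≢v , uv) (v≢w , vw) (u≢w , uw) =
    <⇒≱ (≤-refl {3}) (≤-trans (≤-reflexive (sym size)) (≤2 (tabulate (char triple)) ind))
    where
    triple : VSet n
    triple = ⁅ u ⁆ ∪ (⁅ v ⁆ ∪ ⁅ w ⁆)
    size : Subset.∣ tabulate (char triple) ∣ ≡ 3
    size = trans (card-tabulate (char triple)) (trans
      (card-∪-disjoint λ x xu xvw → [ (λ xv → u≢v (trans (x∈⁅y⁆⁻ xu) (sym (x∈⁅y⁆⁻ xv))))
                                    , (λ xw → u≢w (trans (x∈⁅y⁆⁻ xu) (sym (x∈⁅y⁆⁻ xw)))) ]′ (∪⁻ xvw))
      (cong₂ _+_ (card-⁅⁆ u) (trans (card-∪-disjoint λ x xv xw → v≢w (trans (x∈⁅y⁆⁻ xv) (sym (x∈⁅y⁆⁻ xw))))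
                                    (cong₂ _+_ (card-⁅⁆ v) (card-⁅⁆ w)))))
    one-of : ∀ x → x Subset.∈ tabulate (char triple) → u ≡ x ⊎ (v ≡ x ⊎ w ≡ x)
    one-of x x∈ with ∪⁻ {p = ⁅ u ⁆} {q = ⁅ v ⁆ ∪ ⁅ w ⁆} (mem (trans (sym (lookup∘tabulate (char triple) x)) ([]=⇒lookup x∈)))
    ... | inj₁ xu = inj₁ (x∈⁅y⁆⁻ xu)
    ... | inj₂ xvw = inj₂ ([ inj₁ ∘ x∈⁅y⁆⁻ , inj₂ ∘ x∈⁅y⁆⁻ ]′ (∪⁻ xvw))
    swap : ∀ {x y} → adj G x y ≡ false → adj G y x ≡ false
    swap {x} {y} = trans (Defs.Graph.sym G y x)
    ind : Independent G (tabulate (char triple))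
    ind x y x∈ y∈ with one-of x x∈ | one-of y y∈
    ... | inj₁ refl        | inj₁ refl        = irref G u
    ... | inj₁ refl        | inj₂ (inj₁ refl) = uv
    ... | inj₁ refl        | inj₂ (inj₂ refl) = uw
    ... | inj₂ (inj₁ refl) | inj₁ refl        = swap uv
    ... | inj₂ (inj₁ refl) | inj₂ (inj₁ refl) = irref G v
    ... | inj₂ (inj₁ refl) | inj₂ (inj₂ refl) = vw
    ... | inj₂ (inj₂ refl) | inj₁ refl        = swap uw
    ... | inj₂ (inj₂ refl) | inj₂ (inj₁ refl) = swap vw
    ... | inj₂ (inj₂ refl) | inj₂ (inj₂ refl) = irref G w

  complement : IndependenceNumber G 2 → TriangleFree n
  complement α₂ = record
    { N        = λ v → ｛ nonAdjacent? v ｝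
    ; N-sym    = λ u∈ → let u≢v , uv = ｛｝⁻ _ u∈ in ｛｝⁺ _ (u≢v ∘ sym , trans (Defs.Graph.sym G _ _) uv)
    ; triangle = λ uv vw uw → no-independent-triple α₂ (｛｝⁻ _ uv) (｛｝⁻ _ vw) (｛｝⁻ _ uw)
    }

  ≤-max : ∀ {A : Set} (f : A → ℕ) {x} {xs : List A} → x List.∈ xs → f x ≤ foldr _⊔_ 0 (List.map f xs)
  ≤-max f (here refl) = m≤m⊔n _ _
  ≤-max f (there x∈)  = ≤-trans (≤-max f x∈) (m≤n⊔m _ _)

  -- The vertex `v`, its neighbours and its non-neighbours cover the graph; the summand 29 in the
  -- hypothesis pays for `v` itself.
  complement-dense : (α₂ : IndependenceNumber G 2) → 29 * maxDegree G + 29 < 19 * n → Dense (complement α₂)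
  complement-dense α₂ Δ< v = +-cancelʳ-< (19 * n) (10 * n) _ (begin-strict
    10 * n + 19 * n                      ≡⟨ *-distribʳ-+ n 10 19 ⟨
    29 * n                               ≤⟨ *-monoʳ-≤ 29 count ⟩
    29 * (d + (maxDegree G + 1))         ≡⟨ solve 2 (λ d Δ → con 29 :* (d :+ (Δ :+ con 1)) := con 29 :* d :+ (con 29 :* Δ :+ con 29)) refl d (maxDegree G) ⟩
    29 * d + (29 * maxDegree G + 29)     <⟨ +-monoʳ-< (29 * d) Δ< ⟩
    29 * d + 19 * n                      ∎)
    where
    open ≤-Reasoning
    open +-*-Solver using (solve; con; _:=_; _:+_; _:*_)
    d = card (N (complement α₂) v)
    covered : ∀ x → x ∈ N (complement α₂) v ⊎ x ∈ set (adj G v) ∪ ⁅ v ⁆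
    covered x with v ≟ x | adj G x v in eq
    ... | yes refl | _ = inj₂ (∪⁺ʳ (x∈⁅x⁆ v))
    ... | no v≢x | true = inj₂ (∪⁺ˡ (mem (trans (Defs.Graph.sym G v x) eq)))
    ... | no v≢x | false = inj₁ (｛｝⁺ _ (v≢x ∘ sym , eq))
    count : n ≤ d + (maxDegree G + 1)
    count = begin
      n                                        ≡⟨ card-∁∅ ⟨
      card (∁ ∅)                               ≤⟨ cover-≤ (λ x _ → covered x) ⟩
      d + card (set (adj G v) ∪ ⁅ v ⁆)         ≤⟨ +-monoʳ-≤ d (card-∪-≤ _ _) ⟩
      d + (card (set (adj G v)) + card ⁅ v ⁆)  ≡⟨ cong (d +_) (cong₂ _+_ (sym (card-tabulate (adj G v))) (card-⁅⁆ v)) ⟩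
      d + (degree G v + 1)                     ≤⟨ +-monoʳ-≤ d (+-monoˡ-≤ 1 (≤-max (degree G) (∈-allFin v))) ⟩
      d + (maxDegree G + 1)                    ∎

  module _ (α₂ : IndependenceNumber G 2) where

    private
      H = complement α₂

    adjacent : ∀ {u v} → u ≢ v → u ∉ N H v → adj G u v ≡ true
    adjacent u≢v u∉ = Bool.¬-not λ e → u∉ (｛｝⁺ _ (u≢v , e))

    -- A vertex outside `p` shares the colour of its partner in `p`. Colour classes are single
    -- vertices or edges of `H`, hence independent in `G`.
    colouring : ∀ p → Matching (_↾_ H (N H) p) (∁ p) → Colourable G (card p)
    colouring p m = colour , λ u v uv e → proper u v uv (rank-injective (rep∈ u) (rep∈ v) e)
      where
      rep : Fin n → Fin n
      rep x with x ∈? p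
      ... | yes _ = x
      ... | no _  = match m x
      rep∈ : ∀ x → rep x ∈ p
      rep∈ x with x ∈? p
      ... | yes x∈p = x∈p
      ... | no x∉p  = proj₂ (∩⁻ (match∈ m (∁⁺ x∉p)))
      colour : Fin n → Fin (card p)
      colour x = proj₁ (rank p (rep∈ x))
      clash : ∀ {x y} → adj G x y ≡ true → x ∉ N H y
      clash xy x∈ with () ← trans (sym xy) (proj₂ (｛｝⁻ _ x∈))
      proper : ∀ u v → adj G u v ≡ true → rep u ≢ rep v
      proper u v uv e with u ∈? p | v ∈? p
      ... | yes _   | yes _   = case trans (sym uv) (trans (cong (adj G u) (sym e)) (irref G u)) of λ ()
      ... | yes _   | no v∉p  = clash uv (subst (_∈ N H v) (sym e) (proj₁ (∩⁻ (match∈ m (∁⁺ v∉p)))))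
      ... | no u∉p  | yes _   = clash uv (N-sym H (subst (_∈ N H u) e (proj₁ (∩⁻ (match∈ m (∁⁺ u∉p))))))
      ... | no u∉p  | no v∉p  =
        case trans (sym uv) (trans (cong (adj G u) (sym (matchInj m (∁⁺ u∉p) (∁⁺ v∉p) e))) (irref G u)) of λ ()

-- Routing

-- Hall's condition is immediate, as every nonempty `Q` has all of `T` as its image.
size-matching : (S T : VSet n) → card S ≤ card T → Matching (λ _ → T) S
size-matching S T S≤T = hall-matching (λ _ → T) S λ Q Q⊆S → case any? (_∈? Q) of λ where
  (yes (q , q∈Q)) → ≤-trans (card-⊆ Q⊆S) (≤-trans S≤T (card-⊆ (image⁺ q∈Q)))
  (no ¬q)         → ≤-trans (≤-reflexive (card-none λ x x∈ → ¬q (x , x∈))) z≤n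

module _ (G : Graph n) where

  SameEdge-sym : ∀ {e f} → SameEdge G e f → SameEdge G f e
  SameEdge-sym (inj₁ (refl , refl)) = inj₁ (refl , refl)
  SameEdge-sym (inj₂ (refl , refl)) = inj₂ (refl , refl)

  SameEdge-trans : ∀ {e f g} → SameEdge G e f → SameEdge G f g → SameEdge G e g
  SameEdge-trans (inj₁ (refl , refl)) fg = fg
  SameEdge-trans (inj₂ (refl , refl)) (inj₁ (refl , refl)) = inj₂ (refl , refl)
  SameEdge-trans (inj₂ (refl , refl)) (inj₂ (refl , refl)) = inj₁ (refl , refl)

  -- A strong immersion with branch set `p`, freed from the order on branch vertices: routes exist
  -- in both directions, and those of the same unordered pair may share edges.
  record Routing (p : VSet n) : Set where
    field
      route    : ∀ {u v} → u ∈ p → v ∈ p → u ≢ v → Path G u v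
      separate : ∀ {u v u′ v′ u∈ v∈ u≢v u′∈ v′∈ u′≢v′} → ¬ SameEdge G (u , v) (u′ , v′) →
                 EdgeDisjoint G (walk (route {u} {v} u∈ v∈ u≢v)) (walk (route {u′} {v′} u′∈ v′∈ u′≢v′))
      avoids   : ∀ {u v u∈ v∈ u≢v x} → x List.∈ internal G (walk (route {u} {v} u∈ v∈ u≢v)) → x ∉ p

  immersion : ∀ {p k} → Routing p → k ≤ card p → StrongImmersionOfComplete G k
  immersion {p} {k} routing k≤ = record
    { branch    = branch
    ; branchInj = injective
    ; path      = λ u v u<v → route (element∈ p _) (element∈ p _) (Fin.<⇒≢ u<v ∘ injective)
    ; disjoint  = λ u v u′ v′ u<v u′<v′ ≢ → separate λ where
        (inj₁ (uu′ , vv′)) → ≢ (injective uu′ , injective vv′)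
        (inj₂ (uv′ , vu′)) → <-asym u<v (subst₂ Fin._<_ (sym (injective vu′)) (sym (injective uv′)) u′<v′)
    ; strong    = λ u v u<v x x∈ w eq → avoids x∈ (subst (_∈ p) (sym eq) (element∈ p _))
    }
    where
    open Routing routing
    branch : Fin k → Fin n
    branch i = element p (inject≤ i k≤)
    injective : ∀ {i j} → branch i ≡ branch j → i ≡ j
    injective e = Fin.inject≤-injective k≤ k≤ _ _ (element-injective p e)

  edge-path : ∀ {u v} → u ≢ v → adj G u v ≡ true → Path G u v
  edge-path u≢v uv = record { walk = cons uv nil ; simple = (u≢v ∷ []) ∷ [] ∷ [] }

  clique-routing : ∀ {p} → (∀ {u v} → u ∈ p → v ∈ p → u ≢ v → adj G u v ≡ true) → Routing p
  clique-routing clique = record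
    { route    = λ u∈ v∈ u≢v → edge-path u≢v (clique u∈ v∈ u≢v)
    ; separate = λ { ≢ e e′ (here refl) (here refl) same → ≢ same }
    ; avoids   = λ ()
    }

  -- Here `H` stands for the maximal supergraph of the complement; its distinct nonadjacent vertices
  -- are still adjacent in `G`.
  module _ (H : TriangleFree n) (adjacent : ∀ {u v} → u ≢ v → u ∉ N H v → adj G u v ≡ true)
    (dense : Dense H) (common : ∀ {u v} → u ∉ N H v → ∃ λ w → w ∈ N H u × w ∈ N H v)
    {w r s : Fin n} (max : ∀ v → card (N H v) ≤ card (N H w))
    (r∉J : r ∉ N H w) (s∈J : s ∈ N H w) (dominated : ∀ z → z ∉ N H w → z ∉ N H s → z ∈ N H r) where

    private
      J Z : VSet n
      J = N H w
      Z = ∁ J ∩ ∁ (N H s)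

      Z⊆Nr : Z ⊆ N H r
      Z⊆Nr z∈ = let z∉J , z∉K = ∩⁻ z∈ in dominated _ (∁⁻ z∉J) (∁⁻ z∉K)

      -- By `helly` and `max`, `J` is a largest stable set. Since `Z` lies in `N H r` it is stable,
      -- and `exchange` yields Hall's condition.
      stars : Matching (_↾_ H (N H) J) Z
      stars = hall-matching _ Z λ Q Q⊆Z → exchange H (neighbourhood-stable H w)
        (λ I ind → let u , I⊆ = helly H dense common w I ind in ≤-trans (card-⊆ I⊆) (max u))
        Q (λ x∈ y∈ → neighbourhood-stable H r (Z⊆Nr (Q⊆Z x∈)) (Z⊆Nr (Q⊆Z y∈)))
        (λ x x∈ → ∁⁻ (proj₁ (∩⁻ (Q⊆Z x∈))))

      K∩J : ∀ {x} → x ∈ N H s → x ∉ J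
      K∩J = disjoint-neighbourhoods H s∈J

      -- `N H z` contains the disjoint sets `J ∩ N H z` and `N H s ∩ N H z` but is no larger than
      -- `J`, so enough of `J` remains outside it.
      labels : ∀ z → Matching (λ _ → J ∩ ∁ (N H z)) (N H s ∩ N H z)
      labels z = size-matching _ _ (+-cancelˡ-≤ (card (J ∩ N H z)) _ _ (begin
        card (J ∩ N H z) + card (N H s ∩ N H z) ≤⟨ disjoint-≤ (λ x xJ xK → K∩J (proj₁ (∩⁻ xK)) (proj₁ (∩⁻ xJ))) (proj₂ ∘ ∩⁻) (proj₂ ∘ ∩⁻) ⟩
        card (N H z)                            ≤⟨ max z ⟩
        card J                                  ≡⟨ card-split J (N H z) ⟨
        card (J ∩ N H z) + card (J ∩ ∁ (N H z)) ∎))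
        where open ≤-Reasoning

      star : Fin n → Fin n
      star = match stars

      label : Fin n → Fin n → Fin n
      label z = match (labels z)

      record Cross (k z : Fin n) : Set where
        field
          k∈K : k ∈ N H s
          z∈Z : z ∈ Z
          kz  : k ∈ N H z
        k∉J : k ∉ J
        k∉J = K∩J k∈K
        z∉J : z ∉ J
        z∉J = ∁⁻ (proj₁ (∩⁻ z∈Z))
        k≢z : k ≢ z
        k≢z refl = irreflexive H kz
        star∈J : star z ∈ J
        star∈J = proj₂ (∩⁻ (match∈ stars z∈Z))
        star-z : star z ∈ N H z
        star-z = proj₁ (∩⁻ (match∈ stars z∈Z))
        labelled : label z k ∈ J ∩ ∁ (N H z)
        labelled = match∈ (labels z) (∩⁺ k∈K kz)
        label∈J : label z k ∈ J
        label∈J = proj₁ (∩⁻ labelled)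
        label-z : label z k ∉ N H z
        label-z = ∁⁻ (proj₂ (∩⁻ labelled))
        k≢star : k ≢ star z
        k≢star e = k∉J (subst (_∈ J) (sym e) star∈J)
        k≢label : k ≢ label z k
        k≢label e = k∉J (subst (_∈ J) (sym e) label∈J)
        star≢label : star z ≢ label z k
        star≢label e = label-z (subst (_∈ N H z) e star-z)
        star≢z : star z ≢ z
        star≢z e = z∉J (subst (_∈ J) e star∈J)
        label≢z : label z k ≢ z
        label≢z e = z∉J (subst (_∈ J) e label∈J)
        -- Both ends are neighbours of `z`. The second edge lies within the stable set `J`, and the
        -- third exists by the choice of labels.
        first : adj G k (star z) ≡ true
        first = adjacent k≢star (λ k* → triangle H k* star-z kz)
        second : adj G (star z) (label z k) ≡ true
        second = adjacent star≢label (neighbourhood-stable H w star∈J label∈J)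
        third : adj G (label z k) z ≡ true
        third = adjacent label≢z label-z
      open Cross

      -- The edges of the route between two vertices; k ∈ K and z ∈ Z are joined by k, star z, label z k, z.
      data Piece : Fin n × Fin n → Fin n × Fin n → Set where
        direct : ∀ {u v} → u ∉ J → v ∉ J → Piece (u , v) (u , v)
        left   : ∀ {k z} → Cross k z → Piece (k , z) (k , star z)
        middle : ∀ {k z} → Cross k z → Piece (k , z) (star z , label z k)
        right  : ∀ {k z} → Cross k z → Piece (k , z) (label z k , z)

      same-star : ∀ {k z k′ z′} → Cross k z → Cross k′ z′ → star z ≡ star z′ → z ≡ z′
      same-star c c′ = matchInj stars (z∈Z c) (z∈Z c′)

      same-label : ∀ {k z k′} → Cross k z → Cross k′ z → label z k ≡ label z k′ → k ≡ k′
      same-label {z = z} c c′ = matchInj (labels z) (∩⁺ (k∈K c) (kz c)) (∩⁺ (k∈K c′) (kz c′))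

      -- A middle edge used in both directions closes the hexagon w, star z, z, r, z′, star z′.
      no-conflict : ∀ {k z k′ z′} → Cross k z → Cross k′ z′ → star z ≡ label z′ k′ → label z k ≢ star z′
      no-conflict {k} {z} {k′} {z′} c c′ e e′ = no-hexagon H dense common
        (hexagon (star∈J c) (N-sym H (star-z c)) (N-sym H (Z⊆Nr (z∈Z c))) (Z⊆Nr (z∈Z c′)) (star-z c′) (N-sym H (star∈J c′)))
        (r∉J ∘ N-sym H)
        (λ x → label-z c′ (subst (_∈ N H z′) e x))
        (λ x → label-z c (subst (_∈ N H z) (sym e′) (N-sym H x)))

      Z∩K : ∀ {k z k′ z′} → Cross k z → Cross k′ z′ → k ≢ z′
      Z∩K c c′ refl = ∁⁻ (proj₂ (∩⁻ (z∈Z c′))) (k∈K c)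

      inside : ∀ {x y} → x ∈ J → y ∉ J → x ≢ y
      inside x∈ y∉ refl = y∉ x∈

      -- The ends in `J` reveal the kind of a piece, except that left and right pieces are told
      -- apart by their ends in `K` and `Z`. Then the star determines `z`, and the label together
      -- with `z` determines `k`.
      same-pair : ∀ {e f p q} → Piece p e → Piece q f → SameEdge G e f → SameEdge G p q
      same-pair (direct _ _)   (direct _ _)   same                 = same
      same-pair (direct a b)   (left c)       (inj₁ (_ , e))       = contradiction (sym e) (inside (star∈J c) b)
      same-pair (direct a b)   (left c)       (inj₂ (e , _))       = contradiction (sym e) (inside (star∈J c) a)
      same-pair (direct a b)   (middle c)     (inj₁ (e , _))       = contradiction (sym e) (inside (star∈J c) a)
      same-pair (direct a b)   (middle c)     (inj₂ (_ , e))       = contradiction (sym e) (inside (star∈J c) b)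
      same-pair (direct a b)   (right c)      (inj₁ (e , _))       = contradiction (sym e) (inside (label∈J c) a)
      same-pair (direct a b)   (right c)      (inj₂ (_ , e))       = contradiction (sym e) (inside (label∈J c) b)
      same-pair (left c)       (direct a b)   (inj₁ (_ , e))       = contradiction e (inside (star∈J c) b)
      same-pair (left c)       (direct a b)   (inj₂ (_ , e))       = contradiction e (inside (star∈J c) a)
      same-pair (middle c)     (direct a b)   (inj₁ (e , _))       = contradiction e (inside (star∈J c) a)
      same-pair (middle c)     (direct a b)   (inj₂ (e , _))       = contradiction e (inside (star∈J c) b)
      same-pair (right c)      (direct a b)   (inj₁ (e , _))       = contradiction e (inside (label∈J c) a)
      same-pair (right c)      (direct a b)   (inj₂ (e , _))       = contradiction e (inside (label∈J c) b)
      same-pair (left c)       (left c′)      (inj₁ (e , e′))      = inj₁ (e , same-star c c′ e′)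
      same-pair (left c)       (left c′)      (inj₂ (e , _))       = contradiction (sym e) (inside (star∈J c′) (k∉J c))
      same-pair (left c)       (middle c′)    (inj₁ (e , _))       = contradiction (sym e) (inside (star∈J c′) (k∉J c))
      same-pair (left c)       (middle c′)    (inj₂ (e , _))       = contradiction (sym e) (inside (label∈J c′) (k∉J c))
      same-pair (left c)       (right c′)     (inj₁ (e , _))       = contradiction (sym e) (inside (label∈J c′) (k∉J c))
      same-pair (left c)       (right c′)     (inj₂ (e , _))       = contradiction e (Z∩K c c′)
      same-pair (middle c)     (left c′)      (inj₁ (e , _))       = contradiction e (inside (star∈J c) (k∉J c′))
      same-pair (middle c)     (left c′)      (inj₂ (_ , e))       = contradiction e (inside (label∈J c) (k∉J c′))
      same-pair (middle c)     (middle c′)    (inj₁ (e , e′)) with refl ← same-star c c′ e = inj₁ (same-label c c′ e′ , refl)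
      same-pair (middle c)     (middle c′)    (inj₂ (e , e′))      = contradiction e′ (no-conflict c c′ e)
      same-pair (middle c)     (right c′)     (inj₁ (_ , e))       = contradiction e (inside (label∈J c) (z∉J c′))
      same-pair (middle c)     (right c′)     (inj₂ (e , _))       = contradiction e (inside (star∈J c) (z∉J c′))
      same-pair (right c)      (left c′)      (inj₁ (e , _))       = contradiction e (inside (label∈J c) (k∉J c′))
      same-pair (right c)      (left c′)      (inj₂ (_ , e))       = contradiction (sym e) (Z∩K c′ c)
      same-pair (right c)      (middle c′)    (inj₁ (_ , e))       = contradiction (sym e) (inside (label∈J c′) (z∉J c))
      same-pair (right c)      (middle c′)    (inj₂ (_ , e))       = contradiction (sym e) (inside (star∈J c′) (z∉J c))
      same-pair (right c)      (right c′)     (inj₁ (e , refl))    = inj₁ (same-label c c′ e , refl)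
      same-pair (right c)      (right c′)     (inj₂ (e , _))       = contradiction e (inside (label∈J c) (z∉J c′))

      -- Pieces are listed only in the direction from `k` to `z`; this absorbs the reversal of pairs
      -- and edges.
      Uses : Fin n × Fin n → Fin n × Fin n → Set
      Uses p e = ∃₂ λ q f → SameEdge G p q × SameEdge G e f × Piece q f

      uses-same : ∀ {p q e f} → Uses p e → Uses q f → SameEdge G e f → SameEdge G p q
      uses-same (p′ , e′ , pp′ , ee′ , piece) (q′ , f′ , qq′ , ff′ , piece′) ef =
        SameEdge-trans pp′ (SameEdge-trans
          (same-pair piece piece′ (SameEdge-trans (SameEdge-sym ee′) (SameEdge-trans ef ff′)))
          (SameEdge-sym qq′))

      record Route (u v : Fin n) : Set where
        field
          trail : Path G u v
          uses  : ∀ {e} → e List.∈ edges G (walk trail) → Uses (u , v) e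
          inner : ∀ {x} → x List.∈ internal G (walk trail) → x ∈ J

      same : ∀ {e} → SameEdge G e e
      same = inj₁ (refl , refl)

      flip : ∀ {x y} → SameEdge G (x , y) (y , x)
      flip = inj₂ (refl , refl)

      direct-route : ∀ {u v} → u ∉ J → v ∉ J → u ≢ v → u ∉ N H v → Route u v
      direct-route u∉ v∉ u≢v uv = record
        { trail = edge-path u≢v (adjacent u≢v uv)
        ; uses  = λ { (here refl) → _ , _ , same , same , direct u∉ v∉ }
        ; inner = λ ()
        }

      cross-route : ∀ {k z} → Cross k z → Route k z
      cross-route c = record
        { trail = record
          { walk   = cons (first c) (cons (second c) (cons (third c) nil))
          ; simple = (k≢star c ∷ k≢label c ∷ k≢z c ∷ []) ∷ (star≢label c ∷ star≢z c ∷ []) ∷ (label≢z c ∷ []) ∷ [] ∷ []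
          }
        ; uses = λ where
            (here refl)                 → _ , _ , same , same , left c
            (there (here refl))         → _ , _ , same , same , middle c
            (there (there (here refl))) → _ , _ , same , same , right c
        ; inner = λ where
            (here refl)         → star∈J c
            (there (here refl)) → label∈J c
        }

      reverse-route : ∀ {k z} → Cross k z → Route z k
      reverse-route c = record
        { trail = record
          { walk   = cons (turn (third c)) (cons (turn (second c)) (cons (turn (first c)) nil))
          ; simple = (≢-sym (label≢z c) ∷ ≢-sym (star≢z c) ∷ ≢-sym (k≢z c) ∷ [])
                   ∷ (≢-sym (star≢label c) ∷ ≢-sym (k≢label c) ∷ []) ∷ (≢-sym (k≢star c) ∷ []) ∷ [] ∷ []
          }
        ; uses = λ where
            (here refl)                 → _ , _ , flip , flip , right c
            (there (here refl))         → _ , _ , flip , flip , middle c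
            (there (there (here refl))) → _ , _ , flip , flip , left c
        ; inner = λ where
            (here refl)         → label∈J c
            (there (here refl)) → star∈J c
        }
        where
        turn : ∀ {x y} → adj G x y ≡ true → adj G y x ≡ true
        turn = trans (Defs.Graph.sym G _ _)

      -- Outside `J`, an edge of `H` must join `N H s` to `Z`, since `N H s` is stable and `Z` lies
      -- in the stable set `N H r`.
      any-route : ∀ {u v} → u ∈ ∁ J → v ∈ ∁ J → u ≢ v → Route u v
      any-route {u} {v} u∈ v∈ u≢v with u ∈? N H v | u ∈? N H s | v ∈? N H s
      ... | no uv | _ | _ = direct-route (∁⁻ u∈) (∁⁻ v∈) u≢v uv
      ... | yes uv | yes us | yes vs = contradiction uv (neighbourhood-stable H s us vs)
      ... | yes uv | yes us | no vs = cross-route record { k∈K = us ; z∈Z = ∩⁺ v∈ (∁⁺ vs) ; kz = uv }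
      ... | yes uv | no us | yes vs = reverse-route record { k∈K = vs ; z∈Z = ∩⁺ u∈ (∁⁺ us) ; kz = N-sym H uv }
      ... | yes uv | no us | no vs = contradiction uv
        (neighbourhood-stable H r (dominated _ (∁⁻ u∈) us) (dominated _ (∁⁻ v∈) vs))

    cross-routing : Routing (∁ J)
    cross-routing = record
      { route    = λ u∈ v∈ u≢v → Route.trail (any-route u∈ v∈ u≢v)
      ; separate = λ ≢ e e′ e∈ e′∈ ee′ → ≢ (uses-same (Route.uses (any-route _ _ _) e∈) (Route.uses (any-route _ _ _) e′∈) ee′)
      ; avoids   = λ x∈ x∈∁J → ∁⁻ x∈∁J (Route.inner (any-route _ _ _) x∈)
      }

-- Choice of the branch set

maximum-stable : (H : TriangleFree n) → ∃ λ J → Stable H J × ∀ I → Stable H I → card I ≤ card J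
maximum-stable {n} H = maximise card n card-≤ improve (∅ , λ x∈ → contradiction x∈ x∉∅)
  where
  stable? : ∀ I → Dec (Stable H I)
  stable? I with edge-or-stable H I
  ... | inj₁ (x , y , x∈ , y∈ , xy) = no λ st → st x∈ y∈ xy
  ... | inj₂ st                     = yes st
  improve : ∀ k → Dec (∃ λ I → Stable H I × k < card I)
  improve k = anyVSet? (λ I → stable? I ×-dec (k <? card I)) λ p⊆q q⊆p (st , lt) →
    (λ x∈ y∈ → st (q⊆p x∈) (q⊆p y∈)) , subst (k <_) (card-cong p⊆q q⊆p) lt

Stable-≼ : {H H′ : TriangleFree n} → H ≼ H′ → ∀ {I} → Stable H′ I → Stable H I
Stable-≼ H≼H′ stable x∈ y∈ xy = stable x∈ y∈ (H≼H′ xy)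

module _ (G : Graph n) (α₂ : IndependenceNumber G 2) (dense : Dense (complement G α₂)) where

  private
    H = complement G α₂

  -- Otherwise `J` and `∁ J` would both be stable, yet each with fewer than n/2 vertices.
  outer-edge : (∀ I → Stable H I → card I + card I < n) → ∀ H′ → H ≼ H′ → ∀ {J} → Stable H J →
               ∃₂ λ x y → x ∉ J × y ∉ J × x ∈ N H′ y
  outer-edge small H′ H≼H′ {J} stable with edge-or-stable H′ (∁ J)
  ... | inj₁ (x , y , x∈ , y∈ , xy) = x , y , ∁⁻ x∈ , ∁⁻ y∈ , xy
  ... | inj₂ stable′ = contradiction (+-mono-< (small J stable) (small (∁ J) (Stable-≼ {H = H} {H′} H≼H′ {∁ J} stable′))) (≤⇒≯ (begin
      n + n                                         ≡⟨ cong₂ _+_ (card-∁ J) (card-∁ J) ⟨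
      (card J + card (∁ J)) + (card J + card (∁ J)) ≡⟨ interchange +-commutativeSemigroup (card J) _ _ _ ⟩
      (card J + card J) + (card (∁ J) + card (∁ J)) ∎))
    where
    open ≤-Reasoning

  clique-case : ∀ {J} → Stable H J → (∀ I → Stable H I → card I ≤ card J) → n ≤ card J + card J →
                Colourable G (card J) × Routing G J
  clique-case {J} st max large =
    colouring G α₂ J (hall-matching _ _ (hall-into-stable H dense st max U≤J)) ,
    clique-routing G λ u∈ v∈ u≢v → adjacent G α₂ u≢v (st u∈ v∈)
    where
    U≤J : card (∁ J) ≤ card J
    U≤J = +-cancelˡ-≤ (card J) _ _ (≤-trans (≤-reflexive (card-∁ J)) large)

  cross-case : (∀ I → Stable H I → card I + card I < n) → Fin n → ∃ λ p → Colourable G (card p) × Routing G p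
  cross-case small v₀ =
    let H′ , H≼H′ , close = maximal H
        dense′ = ≼-Dense {H = H} {H′} H≼H′ dense
        common = diameter-2 H′ dense′ close
        w , _ , w-max = argmax (λ _ → yes tt) (card ∘ N H′) n (λ _ → card-≤ _) (v₀ , tt)
        J = N H′ w
        stJ = Stable-≼ {H = H} {H′} H≼H′ {J} (neighbourhood-stable H′ w)
        -- The matching runs along `H`, not `H′`, because matched vertices share a colour and must
        -- be nonadjacent in `G`.
        m = hall-matching _ J (hall-from-stable H dense small stJ)
        x , y , x∉J , y∉J , xy = outer-edge small H′ H≼H′ stJ
        outer? : ∀ z → Dec (z ∉ J × ∃ λ b → b ∉ J × b ∈ N H′ z)
        outer? z = ¬? (z ∈? J) ×-dec any? (λ b → ¬? (b ∈? J) ×-dec (b ∈? N H′ z))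
        -- Maximising the non-neighbours in `J` minimises the neighbours there; `outer-edge` has
        -- supplied a first candidate.
        r , (r∉J , a , a∉J , ar) , r-max = argmax outer? (λ z → card (J ∩ ∁ (N H′ z))) n (λ _ → card-≤ _)
                                             (y , y∉J , x , x∉J , xy)
        s , sr , s∈J = common r∉J
    in ∁ J
     , colouring G α₂ (∁ J) (restrict (λ x∈ → decidable-stable (_ ∈? J) (∁⁻ x∈ ∘ ∁⁺)) m)
     , cross-routing G H′ (λ u≢v u∉ → adjacent G α₂ u≢v (u∉ ∘ H≼H′)) dense′ common (λ v → w-max v tt) r∉J s∈J
         (dominated H′ dense′ common r∉J s∈J sr ar a∉J λ t b t∉ b∉ bt → r-max t (t∉ , b , b∉ , bt))
    where
    restrict : ∀ {R : Fin n → VSet n} {S S′} → S′ ⊆ S → Matching R S → Matching R S′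
    restrict S′⊆S m = record
      { match = match m ; match∈ = match∈ m ∘ S′⊆S ; matchInj = λ x∈ y∈ → matchInj m (S′⊆S x∈) (S′⊆S y∈) }

theorem6 : (n : ℕ) (G : Graph n) → 11 ≤ n → IndependenceNumber G 2 →
    29 * maxDegree G + 29 < 19 * n →
    ∀ k → ChromaticNumber G k → StrongImmersionOfComplete G k
theorem6 n G 11≤n α₂ Δ< k (_ , minimal) = conclude (case n ≤? card J + card J of λ where
    (yes large) → J , clique-case G α₂ dense stable max large
    (no ¬large) → cross-case G α₂ dense (λ I st → ≤-<-trans (+-mono-≤ (max I st) (max I st)) (≰⇒> ¬large))
                    -- The vertex 0, available because n is positive.
                    (fromℕ< (≤-trans (s≤s z≤n) 11≤n)))
  where
  dense = complement-dense G α₂ Δ<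
  J = proj₁ (maximum-stable (complement G α₂))
  stable = proj₁ (proj₂ (maximum-stable (complement G α₂)))
  max = proj₂ (proj₂ (maximum-stable (complement G α₂)))
  -- Minimality of `k` turns the colouring into `k ≤ card p`, so `p` has enough branch vertices.
  conclude : (∃ λ p → Colourable G (card p) × Routing G p) → StrongImmersionOfComplete G k
  conclude (p , colours , routing) = immersion G routing (minimal (card p) colours)
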